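{- The class of Krasner hyperfields, regarded as first-order structures in the language of hyperfields $(\oplus,\ominus,\odot,{}^{ -1},\underline{0},\underline{1})$, is not elementary; that is, there is no set of first-order sentences in this language whose models are exactly the Krasner hyperfields.
   Context: A hyperfield is a tuple $(\mathcal{H},+,\cdot,0,1)$, where $(\mathcal{H}\setminus\{0\},\cdot,1)$ is an abelian group, $x\cdot 0=0\cdot x=0$ for all $x\in\mathcal{H}$, and $+:\mathcal{H}\times\mathcal{H}\to\mathcal{P}(\mathcal{H})\setminus\{\emptyset\}$ (hyperaddition) satisfies the following for all $x,y,z\in\mathcal{H}$ (operations being naturally extended to subsets): $x+y=y+x$; $(x+y)+z=x+(y+z)$; for each $x$ there is a unique $-x\in\mathcal{H}$ with $0\in x+(-x)$; $z\in x+y$ implies $y\in z+(-x)$; $x+0=\{x\}$; $z\cdot(x+y)=z\cdot x+z\cdot y$. For a field $K$ and a subgroup $G\leqslant K^\times$, $K/G$ denotes the set $(K^\times/G)\cup\{0\}$ (where $0$ is regarded as the class of $0\in K$) with $aG\cdot bG=abG$ and $aG+bG=\{(x+y)G\mid x\in aG,\ y\in bG\}$; this is a hyperfield with $1=G$. A Krasner hyperfield is a hyperfield isomorphic to $K/G$ for some field $K$ and some subgroup $G$ of $K^\times$. Language of hyperfields: $\odot$ is a binary function symbol interpreted as multiplication; ${}^{ -1}$ is a unary function symbol interpreted as the multiplicative inverse (with the convention $0^{ -1}=0$); $\oplus$ is a ternary relation symbol with $\oplus(x,y,z)$ if and only if $z\in x+y$; $\ominus$ is a unary function symbol interpreted as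 $x\mapsto -x$; $\underline{0},\underline{1}$ are constant symbols interpreted as $0,1$. -}

module Defs where

open import Level using (Level; _⊔_; suc)
open import Algebra.Bundles using (CommutativeRing)
open import Algebra.Structures using (IsAbelianGroup)
open import Data.Empty.Polymorphic using (⊥)
open import Data.Fin.Base using (Fin)
open import Data.Nat.Base as ℕ using (ℕ)
open import Data.Product.Base using (Σ; ∃; ∃₂; _×_; _,_)
open import Data.Sum.Base using (_⊎_)
open import Data.Vec.Base using (Vec; []; _∷_; lookup)
open import Function.Bundles using (_⇔_)
open import Function.Definitions using (Bijective)
open import Relation.Binary.Core using (Rel)
open import Relation.Binary.Structures using (IsEquivalence)
open import Relation.Nullary.Negation using (¬_)
open import Relation.Unary using (Pred; _∈_; _≐_)
import Relation.Binary.Reasoning.Setoid as SetoidReasoning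

-- z ∈ x + y means that z belongs to the hypersum of x and y.  Sets are setoids,
-- so subsets are predicates and ⟨ x ⟩ is the singleton up to _≈_.

record Hyperstructure (ℓ : Level) : Set (suc ℓ) where
  infixl 7 _*_
  infixl 6 _+_
  infix  4 _≈_
  field
    Carrier       : Set ℓ
    _≈_           : Rel Carrier ℓ
    isEquivalence : IsEquivalence _≈_
    _+_           : Carrier → Carrier → Pred Carrier ℓ
    _*_           : Carrier → Carrier → Carrier
    0#            : Carrier
    1#            : Carrier
    +-resp        : ∀ {x x′ y y′ z z′} → x ≈ x′ → y ≈ y′ → z ≈ z′ →
                    z ∈ x + y → z′ ∈ x′ + y′
    *-cong        : ∀ {x x′ y y′} → x ≈ x′ → y ≈ y′ → x * y ≈ x′ * y′

  open IsEquivalence isEquivalence public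

  ⟨_⟩ : Carrier → Pred Carrier ℓ
  ⟨ x ⟩ y = y ≈ x

  infixl 6 _⊞_
  _⊞_ : Pred Carrier ℓ → Pred Carrier ℓ → Pred Carrier ℓ
  (A ⊞ B) z = ∃₂ λ x y → x ∈ A × y ∈ B × z ∈ x + y

  infixl 7 _⊡_
  _⊡_ : Carrier → Pred Carrier ℓ → Pred Carrier ℓ
  (x ⊡ A) z = ∃ λ y → y ∈ A × z ≈ x * y

  NonZero : Set ℓ
  NonZero = Σ Carrier λ x → ¬ x ≈ 0#

-- Arbitrary first-order structures for the language (⊕, ⊖, ⊙, ⁻¹, 0, 1): the
-- ternary relation ⊕(x,y,z) is z ∈ x + y, and the hyperfield axioms are not
-- assumed.

record LStructure (ℓ : Level) : Set (suc ℓ) where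
  infix 8 _⁻¹ -_
  field
    reduct : Hyperstructure ℓ
  open Hyperstructure reduct public
  field
    -_      : Carrier → Carrier
    _⁻¹     : Carrier → Carrier
    -‿cong  : ∀ {x y} → x ≈ y → - x ≈ - y
    ⁻¹-cong : ∀ {x y} → x ≈ y → x ⁻¹ ≈ y ⁻¹

record IsHyperfield {ℓ : Level} (M : LStructure ℓ) : Set ℓ where
  open LStructure M
  field
    1≉0       : ¬ 1# ≈ 0#
    *-nonzero : ∀ {x y} → ¬ x ≈ 0# → ¬ y ≈ 0# → ¬ x * y ≈ 0#
    ⁻¹-nonzero : ∀ {x} → ¬ x ≈ 0# → ¬ x ⁻¹ ≈ 0#

  _≈ₙ_ : Rel NonZero ℓ
  (x , _) ≈ₙ (y , _) = x ≈ y

  _*ₙ_ : NonZero → NonZero → NonZero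
  (x , x≉0) *ₙ (y , y≉0) = x * y , *-nonzero x≉0 y≉0

  1ₙ : NonZero
  1ₙ = 1# , 1≉0

  _⁻¹ₙ : NonZero → NonZero
  (x , x≉0) ⁻¹ₙ = x ⁻¹ , ⁻¹-nonzero x≉0

  field
    *-isAbelianGroup : IsAbelianGroup _≈ₙ_ _*ₙ_ 1ₙ _⁻¹ₙ
    0⁻¹≈0            : 0# ⁻¹ ≈ 0#
    *-zeroʳ          : ∀ x → x * 0# ≈ 0#
    *-zeroˡ          : ∀ x → 0# * x ≈ 0#
    +-nonempty       : ∀ x y → ∃ λ z → z ∈ x + y
    +-comm           : ∀ x y → x + y ≐ y + x
    +-assoc          : ∀ x y z → (x + y) ⊞ ⟨ z ⟩ ≐ ⟨ x ⟩ ⊞ (y + z)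
    -‿inverse        : ∀ x → 0# ∈ x + (- x)
    -‿unique         : ∀ x y → 0# ∈ x + y → y ≈ - x
    reversible       : ∀ x y z → z ∈ x + y → y ∈ z + (- x)
    +-identityʳ      : ∀ x → x + 0# ≐ ⟨ x ⟩
    distribˡ         : ∀ x y z → z ⊡ (x + y) ≐ (z * x) + (z * y)

record _≅_ {a b : Level} (H : Hyperstructure a) (H′ : Hyperstructure b) : Set (a ⊔ b) where
  private
    module H  = Hyperstructure H
    module H′ = Hyperstructure H′
  field
    to        : H.Carrier → H′.Carrier
    to-cong   : ∀ {x y} → x H.≈ y → to x H′.≈ to y
    bijective : Bijective H._≈_ H′._≈_ to
    +-homo    : ∀ x y z → z ∈ x H.+ y ⇔ to z ∈ to x H′.+ to y
    *-homo    : ∀ x y → to (x H.* y) H′.≈ to x H′.* to y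
    0-homo    : to H.0# H′.≈ H′.0#
    1-homo    : to H.1# H′.≈ H′.1#

record Field (ℓ : Level) : Set (suc ℓ) where
  field
    commutativeRing : CommutativeRing ℓ ℓ
  open CommutativeRing commutativeRing public
  field
    1≉0     : ¬ 1# ≈ 0#
    inverse : ∀ x → ¬ x ≈ 0# → ∃ λ y → x * y ≈ 1#

-- Subgroups of the multiplicative group K^×.  Field has no inverse function, so
-- ⁻¹-closed speaks of any y with xy = 1.

record Subgroup {ℓ : Level} (K : Field ℓ) : Set (suc ℓ) where
  open Field K
  field
    member    : Pred Carrier ℓ
    respects  : ∀ {x y} → x ≈ y → x ∈ member → y ∈ member
    nonzero   : ∀ {x} → x ∈ member → ¬ x ≈ 0#
    1∈        : 1# ∈ member
    *-closed  : ∀ {x y} → x ∈ member → y ∈ member → x * y ∈ member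
    ⁻¹-closed : ∀ {x y} → x ∈ member → x * y ≈ 1# → y ∈ member

-- K / G is carried by K itself, an element x standing for the coset xG;
-- the class of 0 is {0} = 0G.

module _ {ℓ : Level} (K : Field ℓ) (G : Subgroup K) where
  open Field K
  open Subgroup G
  open SetoidReasoning setoid

  SameCoset : Rel Carrier ℓ
  SameCoset x y = ∃ λ g → g ∈ member × x ≈ g * y

  -- c G ∈ aG + bG  iff  cG = (x + y)G for some x ∈ aG and y ∈ bG.
  CosetSum : Carrier → Carrier → Pred Carrier ℓ
  CosetSum a b c = ∃₂ λ x y → SameCoset x a × SameCoset y b × SameCoset c (x + y)

  private
    ~-refl : ∀ {x} → SameCoset x x
    ~-refl {x} = 1# , 1∈ , sym (*-identityˡ x)

    ~-sym : ∀ {x y} → SameCoset x y → SameCoset y x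
    ~-sym {x} {y} (g , g∈ , x≈gy) with inverse g (nonzero g∈)
    ... | h , gh≈1 = h , ⁻¹-closed g∈ gh≈1 , (begin
      y            ≈⟨ *-identityˡ y ⟨
      1# * y       ≈⟨ *-congʳ gh≈1 ⟨
      (g * h) * y  ≈⟨ *-congʳ (*-comm g h) ⟩
      (h * g) * y  ≈⟨ *-assoc h g y ⟩
      h * (g * y)  ≈⟨ *-congˡ x≈gy ⟨
      h * x        ∎)

    ~-trans : ∀ {x y z} → SameCoset x y → SameCoset y z → SameCoset x z
    ~-trans {x} {y} {z} (g , g∈ , x≈gy) (h , h∈ , y≈hz) = g * h , *-closed g∈ h∈ , (begin
      x            ≈⟨ x≈gy ⟩
      g * y        ≈⟨ *-congˡ y≈hz ⟩
      g * (h * z)  ≈⟨ *-assoc g h z ⟨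
      (g * h) * z  ∎)

    ~-* : ∀ {x x′ y y′} → SameCoset x x′ → SameCoset y y′ → SameCoset (x * y) (x′ * y′)
    ~-* {x} {x′} {y} {y′} (g , g∈ , x≈gx′) (h , h∈ , y≈hy′) = g * h , *-closed g∈ h∈ , (begin
      x * y                  ≈⟨ *-cong x≈gx′ y≈hy′ ⟩
      (g * x′) * (h * y′)    ≈⟨ *-assoc g x′ (h * y′) ⟩
      g * (x′ * (h * y′))    ≈⟨ *-congˡ (*-assoc x′ h y′) ⟨
      g * ((x′ * h) * y′)    ≈⟨ *-congˡ (*-congʳ (*-comm x′ h)) ⟩
      g * ((h * x′) * y′)    ≈⟨ *-congˡ (*-assoc h x′ y′) ⟩
      g * (h * (x′ * y′))    ≈⟨ *-assoc g h (x′ * y′) ⟨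
      (g * h) * (x′ * y′)    ∎)

  _/_ : Hyperstructure ℓ
  _/_ = record
    { Carrier       = Carrier
    ; _≈_           = SameCoset
    ; isEquivalence = record { refl = ~-refl ; sym = ~-sym ; trans = ~-trans }
    ; _+_           = CosetSum
    ; _*_           = _*_
    ; 0#            = 0#
    ; 1#            = 1#
    ; +-resp        = λ a~a′ b~b′ c~c′ (x , y , x~a , y~b , c~x+y) →
        x , y , ~-trans x~a a~a′ , ~-trans y~b b~b′ , ~-trans (~-sym c~c′) c~x+y
    ; *-cong        = ~-*
    }

IsKrasner : {ℓ : Level} → LStructure ℓ → Set (suc ℓ)
IsKrasner {ℓ} M = IsHyperfield M ×
  Σ (Field ℓ) λ K → Σ (Subgroup K) λ G → LStructure.reduct M ≅ (K / G)

-- Variables are de Bruijn indices; n bounds the free ones.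

data Term (n : ℕ) : Set where
  var     : Fin n → Term n
  `0 `1   : Term n
  ⊖_ _⁻¹′ : Term n → Term n
  _⊙_     : Term n → Term n → Term n

data Formula (n : ℕ) : Set where
  _≐′_          : Term n → Term n → Formula n
  ⊕             : Term n → Term n → Term n → Formula n
  ⊥′            : Formula n
  _∧′_ _∨′_ _⇒′_ : Formula n → Formula n → Formula n
  ∀′ ∃′         : Formula (ℕ.suc n) → Formula n

Sentence : Set
Sentence = Formula 0

module _ {ℓ : Level} (M : LStructure ℓ) where
  open LStructure M

  ⟦_⟧ : ∀ {n} → Term n → Vec Carrier n → Carrier
  ⟦ var i ⟧ ρ = lookup ρ i
  ⟦ `0 ⟧    ρ = 0#
  ⟦ `1 ⟧    ρ = 1#
  ⟦ ⊖ t ⟧   ρ = - ⟦ t ⟧ ρ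
  ⟦ t ⁻¹′ ⟧ ρ = ⟦ t ⟧ ρ ⁻¹
  ⟦ s ⊙ t ⟧ ρ = ⟦ s ⟧ ρ * ⟦ t ⟧ ρ

  Sat : ∀ {n} → Formula n → Vec Carrier n → Set ℓ
  Sat (s ≐′ t)  ρ = ⟦ s ⟧ ρ ≈ ⟦ t ⟧ ρ
  Sat (⊕ s t u) ρ = ⟦ u ⟧ ρ ∈ ⟦ s ⟧ ρ + ⟦ t ⟧ ρ
  Sat ⊥′        ρ = ⊥
  Sat (φ ∧′ ψ)  ρ = Sat φ ρ × Sat ψ ρ
  Sat (φ ∨′ ψ)  ρ = Sat φ ρ ⊎ Sat ψ ρ
  Sat (φ ⇒′ ψ)  ρ = Sat φ ρ → Sat ψ ρ
  Sat (∀′ φ)    ρ = ∀ x → Sat φ (x ∷ ρ)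
  Sat (∃′ φ)    ρ = ∃ λ x → Sat φ (x ∷ ρ)

_⊨_ : {ℓ t : Level} → LStructure ℓ → Pred Sentence t → Set (ℓ ⊔ t)
M ⊨ T = ∀ φ → φ ∈ T → Sat M φ []

IsElementary : {ℓ c : Level} (t : Level) → Pred (LStructure ℓ) c → Set (suc ℓ ⊔ c ⊔ suc t)
IsElementary {ℓ} t C = ∃ λ (T : Pred Sentence t) → (M : LStructure ℓ) → M ⊨ T ⇔ M ∈ C

{-# OPTIONS --safe #-}
module Submission where

open import Defs
open import Level using (Level)
open import Relation.Nullary.Negation using (¬_)
open import Level using (Lift; lift; lower; 0ℓ; _⊔_)
open import Algebra.Bundles using (AbelianGroup; CommutativeMonoid; CommutativeRing; Group; RawRing)
import Algebra.Morphism.RingMonomorphism as RingMonomorphism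
import Algebra.Properties.AbelianGroup as AbelianGroupProperties
import Algebra.Properties.CommutativeMonoid.Mult as MonoidMult
import Algebra.Properties.CommutativeSemigroup as CommSemigroup
import Algebra.Properties.Ring as RingProperties
import Algebra.Properties.Semiring.Exp as Exp
import Algebra.Solver.Ring
open import Algebra.Solver.Ring.AlmostCommutativeRing using (fromCommutativeRing; _-Raw-AlmostCommutative⟶_)
import Algebra.Solver.Ring.NaturalCoefficients.Default as SemiringSolver
open import Data.Bool.Base using (Bool; true; false; _∨_; _∧_; _xor_)
import Data.Bool.Properties as Bool
open import Data.Empty as Empty using (⊥-elim)
open import Data.Empty.Polymorphic using (⊥)
open import Data.Fin.Base as Fin using (Fin; zero; suc; toℕ)
import Data.Fin.Properties as Fin
open import Data.Integer.Base as ℤ using (+_; +[1+_]; +0; -[1+_])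
import Data.Integer.Properties as ℤ
import Data.Integer.Solver as ℤSolver
open import Data.List.Base as List using (List; []; _∷_; upTo; cartesianProduct; cartesianProductWith)
import Data.List.Membership.Propositional as List
open import Data.List.Membership.Propositional.Properties
open import Data.List.Relation.Unary.Any as Any using (Any)
import Data.List.Relation.Unary.Any.Properties as Any
open import Data.Maybe.Base as Maybe using (Maybe; just; nothing)
open import Data.Maybe.Relation.Binary.Pointwise as Pointwise using (Pointwise; just; nothing; drop-just)
open import Data.Nat.Base as ℕ using (ℕ; zero; suc; _^_; _≤_; _<_; z≤n; s≤s; less; equal; greater)
open import Data.Nat.Coprimality using (Coprime; coprime-Bézout)
open import Data.Nat.Divisibility
  using (_∣_; 0∣⇒≡0; ∣-trans; ∣m⇒∣m*n; ∣n⇒∣m*n; ∣m+n∣m⇒∣n; ∣1⇒≡1; ∣⇒≤; m%n≡0⇒n∣m; n∣m⇒m%n≡0; m∣m*n)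
open import Data.Nat.DivMod using (_%_; _mod_; %-distribˡ-*; %-distribˡ-+)
open import Data.Nat.GCD using (module Bézout)
import Data.Nat.Properties as ℕ
open import Data.Product.Base as Product using (Σ; ∃; ∃₂; _×_; _,_; proj₁; proj₂)
open import Data.Rational.Unnormalised.Base as ℚᵘ using (mkℚᵘ; _≃_; *≡*)
import Data.Rational.Unnormalised.Properties as ℚᵘ
open import Data.Sum.Base as Sum using (_⊎_; inj₁; inj₂; [_,_]; [_,_]′)
open import Data.Vec.Base as Vec using (Vec; []; _∷_; lookup; zipWith; replicate)
import Data.Vec.Properties as Vec
open import Data.Vec.Relation.Unary.All as All using (All; []; _∷_)
open import Function.Base using (_∘_; id; flip)
open import Function.Bundles using (_⇔_; mk⇔; Equivalence)
open import Relation.Binary.Core using (Rel)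
open import Relation.Binary.Definitions using (Decidable)
open import Relation.Binary.PropositionalEquality as ≡ using (_≡_)
import Relation.Binary.Reasoning.Setoid as SetoidReasoning
open import Relation.Binary.Structures using (IsEquivalence)
open import Relation.Nullary.Decidable using (Dec; yes; no; ¬?; decidable-stable; map′; _×-dec_)
open import Relation.Nullary.Negation using (contradiction)
open import Relation.Unary using (Pred)

-- For an abelian group A let L(A) be A ∪ {0} with x + x = {0 , x} and x + y = A ∖ {x , y} for x ≠ y in A.
-- If E is a quadratic extension of a field F with more than two elements, the quotient hyperfield of E by
-- F^× is L(E^× / F^×), because the projective space of E over F is a single line.  Two facts combine.
--
-- L(ℚ) is not Krasner.  A quotient K / G of this shape has k = G ∪ {0} a subfield and K = k(α) quadratic.
-- Since ℚ is torsion-free, K has characteristic 2 and one may take α² = α + a.  Since ℚ has rank one,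
-- y = α³ + α + 1 satisfies y^m = c α^n or y^m α^n = c for some c ∈ k and m, n ≥ 1; conjugating α ↦ α + 1 and
-- eliminating c gives a polynomial relation for α over F₂ with constant term 1.  So α is a root of unity
-- and its class in the torsion-free group ℚ is trivial, a contradiction.
--
-- For E of order 2 ^ 2 ^ (j+1) and F of order 2 ^ 2 ^ j the group E^× / F^× is killed by the Fermat number
-- 2 ^ 2 ^ j + 1, which is prime to 1 , … , j.  Hence for j large it cannot be told from ℚ by a given sentence
-- about L, so L(ℚ) satisfies every sentence that holds in all Krasner hyperfields.

-- Why the cubic: f = T³ + T + 1 has f(0) = f(1) = 1, so both y = f(α) and its conjugate f(α + 1)
-- have constant term 1 in α. So does α + 1, while α has constant term 0. After c is eliminated, α
-- is therefore a factor of exactly one side, and the relation cannot be trivial. With y = α + 1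
-- conjugation would merely swap y and α, and the relation could be empty. The only quadratic with
-- the same two values is T² + T + 1, but α² + α + 1 = a + 1 lies in k. Why Fermat numbers: the
-- conjugate of x over F is x ^ 2 ^ 2 ^ j, so x ^ (2 ^ 2 ^ j + 1) is the norm of x and lies in F. An
-- exponent prime to 1, ... , N makes multiplication by these numbers bijective. Besides
-- nontriviality, that is all the game asks of either group: an equation with a small leading
-- coefficient has exactly one solution, and some element solves none of finitely many given
-- equations. The comparison with ℚ is a finite game with explicit bounds, in place of an
-- ultraproduct of the finite quotients; it needs only decidable equality of the groups.

-- Bounded coefficient vectors and equations.

_⊕ᵥ_ : ∀ {n} → Vec ℕ n → Vec ℕ n → Vec ℕ n
_⊕ᵥ_ = zipWith ℕ._+_

_⊛_ : ∀ {n} → ℕ → Vec ℕ n → Vec ℕ n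
m ⊛ u = Vec.map (m ℕ.*_) u

Bounded : ∀ {n} → ℕ → Vec ℕ n → Set
Bounded N = All (_≤ N)

⊕ᵥ-bounded : ∀ {M N n} {u v : Vec ℕ n} → Bounded M u → Bounded N v → Bounded (M ℕ.+ N) (u ⊕ᵥ v)
⊕ᵥ-bounded []       []       = []
⊕ᵥ-bounded (p ∷ ps) (q ∷ qs) = ℕ.+-mono-≤ p q ∷ ⊕ᵥ-bounded ps qs

⊛-bounded : ∀ {m M N n} {u : Vec ℕ n} → m ≤ M → Bounded N u → Bounded (M ℕ.* N) (m ⊛ u)
⊛-bounded m≤M []       = []
⊛-bounded m≤M (p ∷ ps) = ℕ.*-mono-≤ m≤M p ∷ ⊛-bounded m≤M ps

boundedVecs : ℕ → (n : ℕ) → List (Vec ℕ n)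
boundedVecs N zero    = List.[ [] ]
boundedVecs N (suc n) = cartesianProductWith _∷_ (upTo (suc N)) (boundedVecs N n)

∈-boundedVecs⁺ : ∀ {N n} {u : Vec ℕ n} → Bounded N u → u List.∈ boundedVecs N n
∈-boundedVecs⁺ []       = Any.here ≡.refl
∈-boundedVecs⁺ (p ∷ ps) = ∈-cartesianProductWith⁺ _∷_ (∈-upTo⁺ (s≤s p)) (∈-boundedVecs⁺ ps)

∈-boundedVecs⁻ : ∀ N n {u : Vec ℕ n} → u List.∈ boundedVecs N n → Bounded N u
∈-boundedVecs⁻ N zero    {[]} _ = []
∈-boundedVecs⁻ N (suc n) u∈
  with _ , _ , p∈ , ps∈ , ≡.refl ← ∈-cartesianProductWith⁻ _∷_ (upTo (suc N)) (boundedVecs N n) u∈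
  = ℕ.≤-pred (∈-upTo⁻ p∈) ∷ ∈-boundedVecs⁻ N n ps∈

-- (m , u , v) stands for the equation (1 + m) x + u · as = v · as in the unknown x.
Equation : ℕ → Set
Equation n = ℕ × Vec ℕ n × Vec ℕ n

BoundedEq : ∀ {n} → ℕ → Equation n → Set
BoundedEq N (m , u , v) = m < N × Bounded N u × Bounded N v

equations : ℕ → (n : ℕ) → List (Equation n)
equations N n = cartesianProduct (upTo N) (cartesianProduct (boundedVecs N n) (boundedVecs N n))

∈-equations⁺ : ∀ {N n} {e : Equation n} → BoundedEq N e → e List.∈ equations N n
∈-equations⁺ (m< , u≤ , v≤) =
  ∈-cartesianProduct⁺ (∈-upTo⁺ m<) (∈-cartesianProduct⁺ (∈-boundedVecs⁺ u≤) (∈-boundedVecs⁺ v≤))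

∈-equations⁻ : ∀ N n {e : Equation n} → e List.∈ equations N n → BoundedEq N e
∈-equations⁻ N n e∈
  with m∈ , uv∈ ← ∈-cartesianProduct⁻ (upTo N) _ e∈
  with u∈ , v∈ ← ∈-cartesianProduct⁻ (boundedVecs N n) (boundedVecs N n) uv∈
  = ∈-upTo⁻ m∈ , ∈-boundedVecs⁻ N n u∈ , ∈-boundedVecs⁻ N n v∈

-- The summand `N` keeps the old bound, `N * N + N * N` bounds the coefficients after the unknown is
-- eliminated between two equations, and the number of equations is what the pigeonhole in `avoid`
-- consumes.
stepBound : ℕ → ℕ → ℕ
stepBound N n = N ℕ.+ (N ℕ.* N ℕ.+ N ℕ.* N) ℕ.+ List.length (equations N n)

N≤stepBound : ∀ N n → N ≤ stepBound N n
N≤stepBound N n = ℕ.≤-trans (ℕ.m≤m+n N _) (ℕ.m≤m+n _ (List.length (equations N n)))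

-- Linear equations in an abelian group.

module Combinations {a ℓ} (A : AbelianGroup a ℓ) where
  open AbelianGroup A public
  open Group group public using (_//_)
  open MonoidMult commutativeMonoid public renaming (_×_ to _·_)
  open AbelianGroupProperties A public
    using (∙-cancelˡ; ∙-cancelʳ; ε⁻¹≈ε; ⁻¹-∙-comm; ⁻¹-anti-homo-//; //-rightDividesˡ)
  open CommSemigroup (CommutativeMonoid.commutativeSemigroup commutativeMonoid) public
    using (interchange; xy∙z≈xz∙y)
  open SetoidReasoning setoid

  ·-ε : ∀ m → m · ε ≈ ε
  ·-ε zero    = refl
  ·-ε (suc m) = trans (identityˡ _) (·-ε m)

  //-cross⇒ : ∀ {x y z w} → x // y ≈ z // w → x ∙ w ≈ z ∙ y
  //-cross⇒ {x} {y} {z} {w} eq = begin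
    x ∙ w                ≈⟨ ∙-congʳ (//-rightDividesˡ y x) ⟨
    (x // y) ∙ y ∙ w       ≈⟨ ∙-congʳ (∙-congʳ eq) ⟩
    (z // w) ∙ y ∙ w       ≈⟨ xy∙z≈xz∙y _ _ _ ⟩
    (z // w) ∙ w ∙ y       ≈⟨ ∙-congʳ (//-rightDividesˡ w z) ⟩
    z ∙ y                ∎

  //-cross⇐ : ∀ {x y z w} → x ∙ w ≈ z ∙ y → x // y ≈ z // w
  //-cross⇐ {x} {y} {z} {w} eq = ∙-cancelʳ (y ∙ w) _ _ (begin
    (x // y) ∙ (y ∙ w)     ≈⟨ assoc _ _ _ ⟨
    (x // y) ∙ y ∙ w       ≈⟨ ∙-congʳ (//-rightDividesˡ y x) ⟩
    x ∙ w                ≈⟨ eq ⟩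
    z ∙ y                ≈⟨ ∙-congʳ (//-rightDividesˡ w z) ⟨
    (z // w) ∙ w ∙ y       ≈⟨ assoc _ _ _ ⟩
    (z // w) ∙ (w ∙ y)     ≈⟨ ∙-congˡ (comm w y) ⟩
    (z // w) ∙ (y ∙ w)     ∎)

  dot : ∀ {n} → Vec ℕ n → Vec Carrier n → Carrier
  dot []      []       = ε
  dot (p ∷ u) (x ∷ as) = p · x ∙ dot u as

  dot-⊕ᵥ : ∀ {n} (u v : Vec ℕ n) as → dot (u ⊕ᵥ v) as ≈ dot u as ∙ dot v as
  dot-⊕ᵥ []      []      []       = sym (identityˡ ε)
  dot-⊕ᵥ (p ∷ u) (q ∷ v) (x ∷ as) = begin
    (p ℕ.+ q) · x ∙ dot (u ⊕ᵥ v) as           ≈⟨ ∙-cong (×-homo-+ x p q) (dot-⊕ᵥ u v as) ⟩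
    (p · x ∙ q · x) ∙ (dot u as ∙ dot v as)   ≈⟨ interchange _ _ _ _ ⟩
    (p · x ∙ dot u as) ∙ (q · x ∙ dot v as)   ∎

  dot-⊛ : ∀ {n} m (u : Vec ℕ n) as → dot (m ⊛ u) as ≈ m · dot u as
  dot-⊛ m []      []       = sym (·-ε m)
  dot-⊛ m (p ∷ u) (x ∷ as) = begin
    (m ℕ.* p) · x ∙ dot (m ⊛ u) as   ≈⟨ ∙-cong (sym (×-assocˡ x m p)) (dot-⊛ m u as) ⟩
    m · (p · x) ∙ m · dot u as       ≈⟨ ×-distrib-+ (p · x) (dot u as) m ⟨
    m · (p · x ∙ dot u as)           ∎

  dot-⊛⊕⊛ : ∀ {n} m k (u v : Vec ℕ n) as →
            dot ((m ⊛ u) ⊕ᵥ (k ⊛ v)) as ≈ m · dot u as ∙ k · dot v as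
  dot-⊛⊕⊛ m k u v as = trans (dot-⊕ᵥ (m ⊛ u) (k ⊛ v) as) (∙-cong (dot-⊛ m u as) (dot-⊛ k v as))

  ·-split : ∀ {x w} p m → (suc p ℕ.+ m) · x ∙ w ≈ p · x ∙ (suc m · x ∙ w)
  ·-split {x} p m = trans
    (∙-congʳ (trans (×-congˡ (≡.sym (ℕ.+-suc p m))) (×-homo-+ x p (suc m)))) (assoc _ _ _)

  eliminate : ∀ m m₀ {x u v u₀ v₀} → m₀ · x ∙ u₀ ≈ v₀ → m · x ∙ u ≈ v →
              m · v₀ ∙ m₀ · u ≈ m₀ · v ∙ m · u₀
  eliminate m m₀ {x} {u} {v} {u₀} {v₀} eq₀ eq = begin
    m · v₀ ∙ m₀ · u                      ≈⟨ ∙-congʳ (×-congʳ m eq₀) ⟨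
    m · (m₀ · x ∙ u₀) ∙ m₀ · u           ≈⟨ ∙-congʳ (×-distrib-+ _ _ m) ⟩
    (m · m₀ · x ∙ m · u₀) ∙ m₀ · u       ≈⟨ xy∙z≈xz∙y _ _ _ ⟩
    (m · m₀ · x ∙ m₀ · u) ∙ m · u₀       ≈⟨ ∙-congʳ (∙-congʳ (·-swap x m m₀)) ⟩
    (m₀ · m · x ∙ m₀ · u) ∙ m · u₀       ≈⟨ ∙-congʳ (×-distrib-+ _ _ m₀) ⟨
    m₀ · (m · x ∙ u) ∙ m · u₀            ≈⟨ ∙-congʳ (×-congʳ m₀ eq) ⟩
    m₀ · v ∙ m · u₀                      ∎
    where
    ·-swap : ∀ x m k → m · k · x ≈ k · m · x
    ·-swap x m k = trans (×-assocˡ x m k) (trans (×-congˡ (ℕ.*-comm m k)) (sym (×-assocˡ x k m)))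

  eliminate⁻ : ∀ m m₀ {x u v u₀ v₀} → m₀ · x ∙ u₀ ≈ v₀ → m · v₀ ∙ m₀ · u ≈ m₀ · v ∙ m · u₀ →
               m₀ · (m · x ∙ u) ≈ m₀ · v
  eliminate⁻ m m₀ eq₀ eq = ∙-cancelʳ _ _ _ (trans (sym (eliminate m m₀ eq₀ refl)) eq)

  Solves : ∀ {n} → Carrier → Vec Carrier n → Equation n → Set ℓ
  Solves x as (m , u , v) = suc m · x ∙ dot u as ≈ dot v as

  -- A truncation of "nontrivial, torsion-free and divisible": multiplication by each of 1, ... ,
  -- `N` is bijective. Nontrivial groups of exponent prime to these numbers qualify as well.
  record Good (N : ℕ) : Set (a ⊔ ℓ) where
    field
      ·-cancel   : ∀ m → m < N → ∀ {x y} → suc m · x ≈ suc m · y → x ≈ y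
      divide     : ∀ m → m < N → ∀ x → ∃ λ y → suc m · y ≈ x
      nontrivial : ∃ λ g → ¬ g ≈ ε

    solve : ∀ {n} (as : Vec Carrier n) (e : Equation n) → proj₁ e < N → ∃ λ x → Solves x as e
    solve as (m , u , v) m<N with y , eq ← divide m m<N (dot v as ∙ dot u as ⁻¹) = y , (begin
      suc m · y ∙ dot u as                    ≈⟨ ∙-congʳ eq ⟩
      (dot v as ∙ dot u as ⁻¹) ∙ dot u as     ≈⟨ assoc _ _ _ ⟩
      dot v as ∙ (dot u as ⁻¹ ∙ dot u as)     ≈⟨ ∙-congˡ (inverseˡ _) ⟩
      dot v as ∙ ε                            ≈⟨ identityʳ _ ⟩
      dot v as                                ∎)

    solves-unique : ∀ {n} (as : Vec Carrier n) (e : Equation n) → proj₁ e < N →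
                    ∀ {x y} → Solves x as e → Solves y as e → x ≈ y
    solves-unique as (m , u , v) m<N p q = ·-cancel m m<N (∙-cancelʳ _ _ _ (trans p (sym q)))

  Good-anti : ∀ {M N} → M ≤ N → Good N → Good M
  Good-anti M≤N G = record
    { ·-cancel = λ m m< → ·-cancel m (ℕ.≤-trans m< M≤N)
    ; divide = λ m m< → divide m (ℕ.≤-trans m< M≤N)
    ; nontrivial = nontrivial }
    where open Good G

  multiples-distinct : ∀ {N g} → Good N → ¬ g ≈ ε → ∀ {i j} → i < j → j ≤ N → ¬ i · g ≈ j · g
  multiples-distinct {N} {g} G g≉ε {i} {j} i<j j≤N ig≈jg with m , ≡.refl ← ℕ.m≤n⇒∃[o]m+o≡n i<j =
    g≉ε (Good.·-cancel G m (ℕ.≤-trans (s≤s (ℕ.m≤n+m m i)) j≤N) (begin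
      suc m · g  ≈⟨ sym (∙-cancelˡ (i · g) _ _ (begin
        i · g ∙ ε                ≈⟨ identityʳ _ ⟩
        i · g                    ≈⟨ ig≈jg ⟩
        (suc i ℕ.+ m) · g        ≈⟨ ×-congˡ (≡.sym (ℕ.+-suc i m)) ⟩
        (i ℕ.+ suc m) · g        ≈⟨ ×-homo-+ g i (suc m) ⟩
        i · g ∙ suc m · g        ∎)) ⟩
      ε          ≈⟨ ·-ε (suc m) ⟨
      suc m · ε  ∎))

  module _ (_≟_ : Decidable _≈_) where

    solves? : ∀ {n} x (as : Vec Carrier n) e → Dec (Solves x as e)
    solves? x as (m , u , v) = _ ≟ _

    -- Each equation has at most one solution, and the multiples 0 · g, 1 · g, ... up to the number
    -- of equations are distinct, one more than there are equations. Hence some multiple solves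
    -- none.
    avoid : ∀ {n} N (as : Vec Carrier n) → Good (N ℕ.+ List.length (equations N n)) →
            ∃ λ x → ¬ Any (Solves x as) (equations N n)
    avoid {n} N as G with Fin.any? {n = suc (List.length es)} (λ i → ¬? (Any.any? (solves? (toℕ i · g) as) es))
      where es = equations N n ; g = proj₁ (Good.nontrivial G)
    ... | yes (i , p) = _ , p
    ... | no ¬p = contradiction (Fin.pigeonhole (ℕ.n<1+n _) (Any.index ∘ sol)) clash
      where
      es = equations N n
      g = proj₁ (Good.nontrivial G)
      sol : ∀ i → Any (Solves (toℕ i · g) as) es
      sol i = decidable-stable (Any.any? (solves? _ as) es) (λ q → ¬p (i , q))
      clash : ¬ ∃ λ i → ∃ λ j → i Fin.< j × Any.index (sol i) ≡ Any.index (sol j)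
      clash (i , j , i<j , eq) = multiples-distinct G (proj₂ (Good.nontrivial G)) i<j
        (ℕ.≤-trans (ℕ.≤-pred (Fin.toℕ<n j)) (ℕ.m≤n+m _ N))
        (Good.solves-unique G as e (ℕ.≤-trans (proj₁ (∈-equations⁻ N n (∈-lookup k))) (ℕ.m≤m+n N _))
          (Any.lookup-index (sol i))
          (≡.subst (Solves _ as ∘ List.lookup es) (≡.sym eq) (Any.lookup-index (sol j))))
        where
        k = Any.index (sol i)
        e = List.lookup es k

-- Back and forth between two abelian groups.

module _ {a b ℓ} (A : AbelianGroup a ℓ) (B : AbelianGroup b ℓ) where
  private
    module A = Combinations A
    module B = Combinations B

  -- The truncated quantifier-free type of a tuple. Coefficients are natural numbers on both sides,
  -- so integer relations are expressed without subtraction.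
  Preserves : ∀ {n} → ℕ → Vec A.Carrier n → Vec B.Carrier n → Set ℓ
  Preserves N as bs = ∀ u v → Bounded N u → Bounded N v →
    A.dot u as A.≈ A.dot v as → B.dot u bs B.≈ B.dot v bs

  PreservesSolutions : ∀ {n} → ℕ → Vec A.Carrier n → Vec B.Carrier n → A.Carrier → B.Carrier → Set ℓ
  PreservesSolutions N as bs x y = ∀ e → BoundedEq N e → A.Solves x as e → B.Solves y bs e

  Preserves-anti : ∀ {M N n} {as : Vec A.Carrier n} {bs} → M ≤ N → Preserves N as bs → Preserves M as bs
  Preserves-anti M≤N P u v u≤ v≤ = P u v (All.map (flip ℕ.≤-trans M≤N) u≤) (All.map (flip ℕ.≤-trans M≤N) v≤)

  -- Cancelling the smaller multiple of x from both sides leaves either a relation among the old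
  -- elements or an `Equation` with positive leading coefficient.
  preserves-∷ : ∀ {n N} {as : Vec A.Carrier n} {bs x y} →
                Preserves N as bs → PreservesSolutions N as bs x y → Preserves N (x ∷ as) (y ∷ bs)
  preserves-∷ {N = N} {as} {bs} {x} {y} P S (p ∷ u) (q ∷ v) (p≤ ∷ u≤) (q≤ ∷ v≤) eq with ℕ.compare p q
  ... | equal p = B.∙-congˡ (P u v u≤ v≤ (A.∙-cancelˡ _ _ _ eq))
  ... | less p m = B.sym (B.trans (B.·-split p m)
    (B.∙-congˡ (S (m , v , u) (ℕ.≤-trans (s≤s (ℕ.m≤n+m m p)) q≤ , v≤ , u≤)
      (A.∙-cancelˡ _ _ _ (A.trans (A.sym (A.·-split p m)) (A.sym eq))))))
  ... | greater q m = B.trans (B.·-split q m)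
    (B.∙-congˡ (S (m , u , v) (ℕ.≤-trans (s≤s (ℕ.m≤n+m m q)) p≤ , u≤ , v≤)
      (A.∙-cancelˡ _ _ _ (A.trans (A.sym (A.·-split q m)) eq))))

  -- Eliminating x from (1+m) x + u = v and (1+m₀) x + u₀ = v₀ leaves
  -- (1+m) v₀ + (1+m₀) u = (1+m₀) v + (1+m) u₀, an equation in the as alone.
  preservesSolutions : ∀ {n N N′} {as : Vec A.Carrier n} {bs x y} e₀ → B.Good N′ → BoundedEq N e₀ →
                       N ≤ N′ → Preserves (N ℕ.* N ℕ.+ N ℕ.* N) as bs →
                       A.Solves x as e₀ → B.Solves y bs e₀ → PreservesSolutions N as bs x y
  preservesSolutions {as = as} {bs} {x} {y} (m₀ , u₀ , v₀) G (m₀≤ , u₀≤ , v₀≤) N≤N′ P a₀ b₀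
                     (m , u , v) (m≤ , u≤ , v≤) a₁ =
    B.Good.·-cancel G m₀ (ℕ.≤-trans m₀≤ N≤N′)
      (B.eliminate⁻ (suc m) (suc m₀) b₀ (B.trans (B.sym (B.dot-⊛⊕⊛ (suc m) (suc m₀) v₀ u bs)) (B.trans
        (P ((suc m ⊛ v₀) ⊕ᵥ (suc m₀ ⊛ u)) ((suc m₀ ⊛ v) ⊕ᵥ (suc m ⊛ u₀))
          (⊕ᵥ-bounded (⊛-bounded m≤ v₀≤) (⊛-bounded m₀≤ u≤))
          (⊕ᵥ-bounded (⊛-bounded m₀≤ v≤) (⊛-bounded m≤ u₀≤))
          (A.trans (A.dot-⊛⊕⊛ (suc m) (suc m₀) v₀ u as) (A.trans (A.eliminate (suc m) (suc m₀) a₀ a₁)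
            (A.sym (A.dot-⊛⊕⊛ (suc m₀) (suc m) v u₀ as)))))
        (B.dot-⊛⊕⊛ (suc m₀) (suc m) v u₀ bs))))

module _ {a b ℓ} (A : AbelianGroup a ℓ) (B : AbelianGroup b ℓ)
         (_≟_ : Decidable (AbelianGroup._≈_ A)) (_≟′_ : Decidable (AbelianGroup._≈_ B)) where
  private
    module A = Combinations A
    module B = Combinations B

  Agree : ∀ {n} → ℕ → Vec A.Carrier n → Vec B.Carrier n → Set ℓ
  Agree N as bs = Preserves A B N as bs × Preserves B A N bs as

  -- If x solves a bounded equation, y is the solution of the same equation over `bs`, and
  -- elimination carries over all other equations. If x solves none, y is chosen to solve none
  -- either.
  agree-extend : ∀ {n} N {as : Vec A.Carrier n} {bs} → A.Good (stepBound N n) → B.Good (stepBound N n) →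
                 Agree (stepBound N n) as bs → ∀ x → ∃ λ y → Agree N (x ∷ as) (y ∷ bs)
  agree-extend {n} N {as} {bs} GA GB (P , Q) x with Any.any? (A.solves? _≟_ x as) (equations N n)
  ... | yes sol = y , preserves-∷ A B (Preserves-anti A B N≤ P)
                        (preservesSolutions A B e GB e≤ N≤ (Preserves-anti A B 2N²≤ P) x-solves y-solves)
                    , preserves-∷ B A (Preserves-anti B A N≤ Q)
                        (preservesSolutions B A e GA e≤ N≤ (Preserves-anti B A 2N²≤ Q) y-solves x-solves)
    where
    N≤ = N≤stepBound N n
    2N²≤ = ℕ.≤-trans (ℕ.m≤n+m (N ℕ.* N ℕ.+ N ℕ.* N) N) (ℕ.m≤m+n _ (List.length (equations N n)))
    e = List.lookup (equations N n) (Any.index sol)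
    x-solves = Any.lookup-index sol
    e≤ = ∈-equations⁻ N n (∈-lookup (Any.index sol))
    root = B.Good.solve GB bs e (ℕ.≤-trans (proj₁ e≤) N≤)
    y = proj₁ root
    y-solves = proj₂ root
  ... | no ¬sol = y , preserves-∷ A B (Preserves-anti A B N≤ P)
                        (λ e e≤ s → contradiction (List.lose (∈-equations⁺ e≤) s) ¬sol)
                    , preserves-∷ B A (Preserves-anti B A N≤ Q)
                        (λ e e≤ s → contradiction (List.lose (∈-equations⁺ e≤) s) (proj₂ generic))
    where
    N≤ = N≤stepBound N n
    generic = B.avoid _≟′_ N bs (B.Good-anti (ℕ.+-monoˡ-≤ _ (ℕ.m≤m+n N _)) GB)
    y = proj₁ generic

-- Lines as structures, and terms as monomials.

-- Hyperaddition z ∈ x + y on a line: x + x = {0 , x}, and for distinct nonzero x, y the sum x + y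
-- consists of all other nonzero elements.
collinear : ∀ {n} → Term n → Term n → Term n → Formula n
collinear s t u =
  ((s ≐′ `0) ∧′ (t ≐′ u)) ∨′ (((t ≐′ `0) ∧′ (s ≐′ u)) ∨′ (((u ≐′ `0) ∧′ (s ≐′ t)) ∨′
  (((s ≐′ t) ∧′ (t ≐′ u)) ∨′
  ((s ≢′ `0) ∧′ ((t ≢′ `0) ∧′ ((u ≢′ `0) ∧′ ((s ≢′ t) ∧′ ((t ≢′ u) ∧′ (s ≢′ u)))))))))
  where
  _≢′_ : ∀ {n} → Term n → Term n → Formula n
  s ≢′ t = (s ≐′ t) ⇒′ ⊥′

-- What Sat makes of the formula collinear.
module _ {ℓ} {C : Set ℓ} (_≈_ : Rel C ℓ) (0# : C) where
  CollinearIn : C → C → C → Set ℓ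
  CollinearIn x y z =
    (x ≈ 0# × y ≈ z) ⊎ (y ≈ 0# × x ≈ z) ⊎ (z ≈ 0# × x ≈ y) ⊎ (x ≈ y × y ≈ z) ⊎
    (x ≉ 0# × y ≉ 0# × z ≉ 0# × x ≉ y × y ≉ z × x ≉ z)
    where
    _≉_ : C → C → Set ℓ
    x ≉ y = x ≈ y → ⊥ {ℓ}

Collinear : ∀ {ℓ} (M : LStructure ℓ) (x y z : LStructure.Carrier M) → Set ℓ
Collinear M = CollinearIn (LStructure._≈_ M) (LStructure.0# M)

-- A presentation of M as L(`group`), with `emb` identifying the group with the nonzero elements. It
-- covers both coset structures and structures built from a group.
record Line {ℓ} (M : LStructure ℓ) : Set (Level.suc ℓ) where
  open LStructure M
  field
    group : AbelianGroup ℓ ℓ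
  open Combinations group using (_∙_; ε) renaming (Carrier to A; _≈_ to _≈ᵍ_; _⁻¹ to inv)
  field
    _≟_           : Decidable _≈ᵍ_
    emb           : A → Carrier
    emb-cong      : ∀ {x y} → x ≈ᵍ y → emb x ≈ emb y
    emb-injective : ∀ {x y} → emb x ≈ emb y → x ≈ᵍ y
    emb≉0         : ∀ {x} → ¬ emb x ≈ 0#
    view          : ∀ x → x ≈ 0# ⊎ ∃ λ a → x ≈ emb a
    emb-*         : ∀ x y → emb x * emb y ≈ emb (x ∙ y)
    emb-1         : 1# ≈ emb ε
    emb-⁻¹        : ∀ x → emb x ⁻¹ ≈ emb (inv x)
    0⁻¹≈0         : 0# ⁻¹ ≈ 0#
    *-zeroˡ       : ∀ x → 0# * x ≈ 0#
    *-zeroʳ       : ∀ x → x * 0# ≈ 0#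
    -x≈x          : ∀ x → - x ≈ x
    +-collinear   : ∀ x y z → (x + y) z ⇔ Collinear M x y z

unit : ∀ {n} → Fin n → Vec ℕ n
unit zero    = 1 ∷ replicate _ 0
unit (suc i) = 0 ∷ unit i

-- On nonzero arguments a term is a monomial with exponents `num` minus `den`; `⊖` leaves it alone
-- because -x = x on a line. For a vanishing term the exponents are placeholders overridden by
-- `vanishes`.
num den : ∀ {n} → Term n → Vec ℕ n
num (var i) = unit i
num `0      = replicate _ 0
num `1      = replicate _ 0
num (⊖ t)   = num t
num (t ⁻¹′) = den t
num (s ⊙ t) = num s ⊕ᵥ num t
den (var i) = replicate _ 0
den `0      = replicate _ 0
den `1      = replicate _ 0
den (⊖ t)   = den t
den (t ⁻¹′) = num t
den (s ⊙ t) = den s ⊕ᵥ den t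

degree : ∀ {n} → Term n → ℕ
degree (var i) = 1
degree `0      = 0
degree `1      = 0
degree (⊖ t)   = degree t
degree (t ⁻¹′) = degree t
degree (s ⊙ t) = degree s ℕ.+ degree t

replicate-bounded : ∀ n {N} → Bounded N (replicate n 0)
replicate-bounded zero    = []
replicate-bounded (suc n) = z≤n ∷ replicate-bounded n

unit-bounded : ∀ {n} (i : Fin n) → Bounded 1 (unit i)
unit-bounded zero    = s≤s z≤n ∷ replicate-bounded _
unit-bounded (suc i) = z≤n ∷ unit-bounded i

num-bounded : ∀ {n} (t : Term n) → Bounded (degree t) (num t)
den-bounded : ∀ {n} (t : Term n) → Bounded (degree t) (den t)
num-bounded (var i) = unit-bounded i
num-bounded `0      = replicate-bounded _
num-bounded `1      = replicate-bounded _
num-bounded (⊖ t)   = num-bounded t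
num-bounded (t ⁻¹′) = den-bounded t
num-bounded (s ⊙ t) = ⊕ᵥ-bounded (num-bounded s) (num-bounded t)
den-bounded (var i) = replicate-bounded _
den-bounded `0      = replicate-bounded _
den-bounded `1      = replicate-bounded _
den-bounded (⊖ t)   = den-bounded t
den-bounded (t ⁻¹′) = num-bounded t
den-bounded (s ⊙ t) = ⊕ᵥ-bounded (den-bounded s) (den-bounded t)

vanishes : ∀ {n} → Vec Bool n → Term n → Bool
vanishes zs (var i) = lookup zs i
vanishes zs `0      = true
vanishes zs `1      = false
vanishes zs (⊖ t)   = vanishes zs t
vanishes zs (t ⁻¹′) = vanishes zs t
vanishes zs (s ⊙ t) = vanishes zs s ∨ vanishes zs t

module Coordinates {ℓ} {M : LStructure ℓ} (L : Line M) where
  open LStructure M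
  open Line L
  private module A = Combinations group

  point : Bool → A.Carrier → Carrier
  point true  _ = 0#
  point false a = emb a

  point-cong : ∀ z {a b} → a A.≈ b → point z a ≈ point z b
  point-cong true  _ = refl
  point-cong false p = emb-cong p

  -- A zero entry is flagged in `zs` and still carries a dummy coordinate, so that coordinates and
  -- variables share their indices.
  Represents : ∀ {n} → Vec Bool n → Vec A.Carrier n → Vec Carrier n → Set ℓ
  Represents zs as ρ = ∀ i → lookup ρ i ≈ point (lookup zs i) (lookup as i)

  represents-∷ : ∀ {n z a x} {zs : Vec Bool n} {as ρ} → x ≈ point z a →
                 Represents zs as ρ → Represents (z ∷ zs) (a ∷ as) (x ∷ ρ)
  represents-∷ p R zero    = p
  represents-∷ p R (suc i) = R i

  value : ∀ {n} → Term n → Vec A.Carrier n → A.Carrier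
  value t as = A.dot (num t) as A.// A.dot (den t) as

  dot-0 : ∀ {n} (as : Vec A.Carrier n) → A.dot (replicate n 0) as A.≈ A.ε
  dot-0 []       = A.refl
  dot-0 (x ∷ as) = A.trans (A.identityˡ _) (dot-0 as)

  dot-unit : ∀ {n} (i : Fin n) as → A.dot (unit i) as A.≈ lookup as i
  dot-unit zero    (x ∷ as) = A.trans (A.∙-cong (A.identityʳ x) (dot-0 as)) (A.identityʳ x)
  dot-unit (suc i) (x ∷ as) = A.trans (A.identityˡ _) (dot-unit i as)

  point-⁻¹ : ∀ z a → point z a ⁻¹ ≈ point z (a A.⁻¹)
  point-⁻¹ true  a = 0⁻¹≈0
  point-⁻¹ false a = emb-⁻¹ a

  point-* : ∀ z w a b → point z a * point w b ≈ point (z ∨ w) (a A.∙ b)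
  point-* true  _     a b = *-zeroˡ _
  point-* false true  a b = *-zeroʳ _
  point-* false false a b = emb-* a b

  evaluate : ∀ {n} (t : Term n) {zs as ρ} → Represents zs as ρ →
             ⟦_⟧ M t ρ ≈ point (vanishes zs t) (value t as)
  evaluate (var i) {zs} {as} R = trans (R i) (point-cong (lookup zs i) (A.sym
    (A.trans (A.∙-cong (dot-unit i as) (A.trans (A.⁻¹-cong (dot-0 as)) A.ε⁻¹≈ε)) (A.identityʳ _))))
  evaluate `0      R = refl
  evaluate `1 {as = as} R = trans emb-1 (emb-cong (A.sym (A.inverseʳ _)))
  evaluate (⊖ t)   R = trans (-x≈x _) (evaluate t R)
  evaluate (t ⁻¹′) {zs} {as} R = trans (⁻¹-cong (evaluate t R)) (trans (point-⁻¹ (vanishes zs t) _)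
    (point-cong (vanishes zs t) (A.⁻¹-anti-homo-// _ _)))
  evaluate (s ⊙ t) {zs} {as} R = trans (*-cong (evaluate s R) (evaluate t R))
    (trans (point-* (vanishes zs s) (vanishes zs t) _ _) (point-cong (vanishes zs s ∨ vanishes zs t) (A.sym (A.trans
      (A.∙-cong (A.dot-⊕ᵥ (num s) (num t) as)
        (A.trans (A.⁻¹-cong (A.dot-⊕ᵥ (den s) (den t) as)) (A.sym (A.⁻¹-∙-comm _ _))))
      (A.interchange _ _ _ _)))))

  value-≈⇒ : ∀ {n} (s t : Term n) as → value s as A.≈ value t as →
             A.dot (num s ⊕ᵥ den t) as A.≈ A.dot (num t ⊕ᵥ den s) as
  value-≈⇒ s t as eq = A.trans (A.dot-⊕ᵥ (num s) (den t) as)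
    (A.trans (A.//-cross⇒ eq) (A.sym (A.dot-⊕ᵥ (num t) (den s) as)))

  value-≈⇐ : ∀ {n} (s t : Term n) as → A.dot (num s ⊕ᵥ den t) as A.≈ A.dot (num t ⊕ᵥ den s) as →
             value s as A.≈ value t as
  value-≈⇐ s t as eq = A.//-cross⇐ (A.trans (A.sym (A.dot-⊕ᵥ (num s) (den t) as))
    (A.trans eq (A.dot-⊕ᵥ (num t) (den s) as)))

-- Transfer of formulas by the Ehrenfeucht-Fraïssé game.

-- Two monomials are compared after clearing denominators, so exponents up to the sum of the degrees
-- occur. A quantifier costs one round of the game, hence one `stepBound`.
bound : ∀ {n} → Formula n → ℕ
bound (s ≐′ t)       = degree s ℕ.+ degree t
bound (⊕ s t u)      = degree s ℕ.+ degree t ℕ.+ degree u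
bound ⊥′             = 0
bound (φ ∧′ ψ)       = bound φ ℕ.+ bound ψ
bound (φ ∨′ ψ)       = bound φ ℕ.+ bound ψ
bound (φ ⇒′ ψ)       = bound φ ℕ.+ bound ψ
bound {n} (∀′ φ)     = stepBound (bound φ) n
bound {n} (∃′ φ)     = stepBound (bound φ) n

-- A position of the Ehrenfeucht–Fraïssé game: the two structures and the tuples ρ, ρ′ only
-- resemble each other up to N.
record Match {ℓ} {M M′ : LStructure ℓ} (L : Line M) (L′ : Line M′) (N : ℕ) {n}
             (ρ : Vec (LStructure.Carrier M) n) (ρ′ : Vec (LStructure.Carrier M′) n) : Set ℓ where
  private
    module L  = Line L
    module L′ = Line L′
    module A  = Combinations L.group
    module A′ = Combinations L′.group
  field
    good        : A.Good N
    good′       : A′.Good N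
    zeros       : Vec Bool n
    {coords}    : Vec A.Carrier n
    {coords′}   : Vec A′.Carrier n
    represents  : Coordinates.Represents L zeros coords ρ
    represents′ : Coordinates.Represents L′ zeros coords′ ρ′
    preserves   : Preserves L.group L′.group N coords coords′
    preserves⁻  : Preserves L′.group L.group N coords′ coords

module _ {ℓ} {M M′ : LStructure ℓ} {L : Line M} {L′ : Line M′} where
  private
    module M  = LStructure M
    module M′ = LStructure M′
    module L  = Line L
    module L′ = Line L′
    module C  = Coordinates L
    module C′ = Coordinates L′
    module A  = Combinations L.group
    module A′ = Combinations L′.group

  match-sym : ∀ {N n} {ρ : Vec M.Carrier n} {ρ′} → Match L L′ N ρ ρ′ → Match L′ L N ρ′ ρ
  match-sym m = record
    { good = good′ ; good′ = good ; zeros = zeros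
    ; represents = represents′ ; represents′ = represents
    ; preserves = preserves⁻ ; preserves⁻ = preserves }
    where open Match m

  match-anti : ∀ {N K n} {ρ : Vec M.Carrier n} {ρ′} → K ≤ N → Match L L′ N ρ ρ′ → Match L L′ K ρ ρ′
  match-anti K≤N m = record
    { good = A.Good-anti K≤N good ; good′ = A′.Good-anti K≤N good′ ; zeros = zeros
    ; represents = represents ; represents′ = represents′
    ; preserves = Preserves-anti L.group L′.group K≤N preserves
    ; preserves⁻ = Preserves-anti L′.group L.group K≤N preserves⁻ }
    where open Match m

  match-extend : ∀ {N n} {ρ : Vec M.Carrier n} {ρ′} → Match L L′ (stepBound N n) ρ ρ′ →
                 ∀ x → ∃ λ x′ → Match L L′ N (x ∷ ρ) (x′ ∷ ρ′)
  match-extend {N} {n} {ρ} {ρ′} m x =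
    -- Zero is answered by zero, with ε as its dummy coordinate.
    [ (λ x≈0 → _ , cons true A.ε x≈0) , (λ (a , x≈a) → _ , cons false a x≈a) ]′ (L.view x)
    where
    open Match m using (good; good′; zeros; coords; coords′; represents; represents′; preserves; preserves⁻)
    partner = agree-extend L.group L′.group L._≟_ L′._≟_ N good good′ (preserves , preserves⁻)
    cons : ∀ z a → x M.≈ C.point z a → Match L L′ N (x ∷ ρ) (C′.point z (proj₁ (partner a)) ∷ ρ′)
    cons z a x≈ = record
      { good = A.Good-anti (N≤stepBound N n) good ; good′ = A′.Good-anti (N≤stepBound N n) good′
      ; zeros = z ∷ zeros
      ; represents = C.represents-∷ x≈ represents ; represents′ = C′.represents-∷ M′.refl represents′
      ; preserves = proj₁ (proj₂ (partner a)) ; preserves⁻ = proj₂ (proj₂ (partner a)) }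

  ≐-transfer : ∀ {N n} {ρ : Vec M.Carrier n} {ρ′} → Match L L′ N ρ ρ′ → ∀ s t → degree s ℕ.+ degree t ≤ N →
               Sat M (s ≐′ t) ρ → Sat M′ (s ≐′ t) ρ′
  ≐-transfer m s t N≤ eq = M′.trans (C′.evaluate s represents′) (M′.trans
    (points (vanishes zeros s) (vanishes zeros t)
      (M.trans (M.sym (C.evaluate s represents)) (M.trans eq (C.evaluate t represents))))
    (M′.sym (C′.evaluate t represents′)))
    where
    open Match m using (zeros; coords; coords′; represents; represents′; preserves)
    values : C.value s coords A.≈ C.value t coords → C′.value s coords′ A′.≈ C′.value t coords′
    values p = C′.value-≈⇐ s t coords′ (Preserves-anti L.group L′.group N≤ preserves _ _
      (⊕ᵥ-bounded (num-bounded s) (den-bounded t))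
      (≡.subst (λ N → Bounded N (num t ⊕ᵥ den s)) (ℕ.+-comm (degree t) (degree s))
        (⊕ᵥ-bounded (num-bounded t) (den-bounded s)))
      (C.value-≈⇒ s t coords p))
    points : ∀ z w → C.point z (C.value s coords) M.≈ C.point w (C.value t coords) →
             C′.point z (C′.value s coords′) M′.≈ C′.point w (C′.value t coords′)
    points true  true  p = M′.refl
    points true  false p = contradiction (M.sym p) L.emb≉0
    points false true  p = contradiction p L.emb≉0
    points false false p = L′.emb-cong (values (L.emb-injective p))

-- The last alternative of `collinear` consists of inequalities and is carried over by the match
-- read backwards.
⊕-transfer : ∀ {ℓ} {M M′ : LStructure ℓ} {L : Line M} {L′ : Line M′} {N n} {ρ : Vec (LStructure.Carrier M) n} {ρ′} →
             Match L L′ N ρ ρ′ → ∀ s t u → degree s ℕ.+ degree t ℕ.+ degree u ≤ N →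
             Sat M (collinear s t u) ρ → Sat M′ (collinear s t u) ρ′
⊕-transfer m s t u N≤ =
  [ (λ (p , q) → inj₁ (to s `0 s0≤ p , to t u tu≤ q)) , inj₂ ∘
  [ (λ (p , q) → inj₁ (to t `0 t0≤ p , to s u su≤ q)) , inj₂ ∘
  [ (λ (p , q) → inj₁ (to u `0 u0≤ p , to s t st≤ q)) , inj₂ ∘
  [ (λ (p , q) → inj₁ (to s t st≤ p , to t u tu≤ q)) , inj₂ ∘
    (λ (p₁ , p₂ , p₃ , p₄ , p₅ , p₆) →
      p₁ ∘ from s `0 s0≤ , p₂ ∘ from t `0 t0≤ , p₃ ∘ from u `0 u0≤ ,
      p₄ ∘ from s t st≤ , p₅ ∘ from t u tu≤ , p₆ ∘ from s u su≤) ] ] ] ]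
  where
  to   = ≐-transfer m
  from = ≐-transfer (match-sym m)
  st≤ = ℕ.≤-trans (ℕ.m≤m+n _ (degree u)) N≤
  tu≤ = ℕ.≤-trans (ℕ.m≤n+m _ (degree s)) (ℕ.≤-trans (ℕ.≤-reflexive (≡.sym (ℕ.+-assoc (degree s) _ _))) N≤)
  su≤ = ℕ.≤-trans (ℕ.+-monoˡ-≤ (degree u) (ℕ.m≤m+n (degree s) (degree t))) N≤
  s0≤ = ℕ.≤-trans (ℕ.+-monoʳ-≤ (degree s) z≤n) st≤
  t0≤ = ℕ.≤-trans (ℕ.+-monoʳ-≤ (degree t) z≤n) tu≤
  u0≤ = ℕ.≤-trans (ℕ.≤-reflexive (ℕ.+-comm (degree u) 0)) (ℕ.≤-trans (ℕ.m≤n+m _ (degree s)) su≤)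

-- Premises of implications and challenges from a universal quantifier travel from M′ back to M,
-- which the symmetry of `Match` allows.
transfer : ∀ {ℓ n} (φ : Formula n) {M M′ : LStructure ℓ} {L : Line M} {L′ : Line M′} {ρ ρ′} →
           Match L L′ (bound φ) ρ ρ′ → Sat M φ ρ → Sat M′ φ ρ′
transfer (s ≐′ t) m = ≐-transfer m s t ℕ.≤-refl
transfer (⊕ s t u) {L = L} {L′} m =
  Equivalence.from (Line.+-collinear L′ _ _ _) ∘ ⊕-transfer m s t u ℕ.≤-refl ∘ Equivalence.to (Line.+-collinear L _ _ _)
transfer ⊥′ m ()
transfer (φ ∧′ ψ) m = Product.map
  (transfer φ (match-anti (ℕ.m≤m+n _ _) m)) (transfer ψ (match-anti (ℕ.m≤n+m _ (bound φ)) m))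
transfer (φ ∨′ ψ) m = Sum.map
  (transfer φ (match-anti (ℕ.m≤m+n _ _) m)) (transfer ψ (match-anti (ℕ.m≤n+m _ (bound φ)) m))
transfer (φ ⇒′ ψ) m f = transfer ψ (match-anti (ℕ.m≤n+m _ (bound φ)) m) ∘ f ∘
  transfer φ (match-sym (match-anti (ℕ.m≤m+n _ _) m))
transfer (∀′ φ) m f x′ with x , m′ ← match-extend (match-sym m) x′ = transfer φ (match-sym m′) (f x)
transfer (∃′ φ) m (x , p) with x′ , m′ ← match-extend m x = x′ , transfer φ m′ p

-- The quotient of a field by a group of units is a hyperfield.

module FieldProperties {ℓ} (K : Field ℓ) where
  open Field K
  open SetoidReasoning setoid

  xy≈0⇒y≈0 : ∀ {x y} → ¬ x ≈ 0# → x * y ≈ 0# → y ≈ 0#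
  xy≈0⇒y≈0 {x} {y} x≉0 xy≈0 with x⁻¹ , xx⁻¹≈1 ← inverse x x≉0 = begin
    y                ≈⟨ *-identityˡ y ⟨
    1# * y           ≈⟨ *-congʳ (trans (*-comm x⁻¹ x) xx⁻¹≈1) ⟨
    (x⁻¹ * x) * y    ≈⟨ *-assoc x⁻¹ x y ⟩
    x⁻¹ * (x * y)    ≈⟨ *-congˡ xy≈0 ⟩
    x⁻¹ * 0#         ≈⟨ zeroʳ x⁻¹ ⟩
    0#               ∎

  *-nonzero : ∀ {x y} → ¬ x ≈ 0# → ¬ y ≈ 0# → ¬ x * y ≈ 0#
  *-nonzero x≉0 y≉0 = y≉0 ∘ xy≈0⇒y≈0 x≉0

  factorˡ≉0 : ∀ {x y} → ¬ x * y ≈ 0# → ¬ x ≈ 0#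
  factorˡ≉0 {y = y} xy≉0 x≈0 = xy≉0 (trans (*-congʳ x≈0) (zeroˡ y))

  factorʳ≉0 : ∀ {x y} → ¬ x * y ≈ 0# → ¬ y ≈ 0#
  factorʳ≉0 {x} xy≉0 y≈0 = xy≉0 (trans (*-congˡ y≈0) (zeroʳ x))

module Cosets {ℓ} (K : Field ℓ) (G : Subgroup K) where
  open Field K
  open Hyperstructure (K / G) public using () renaming (refl to ∼-refl; sym to ∼-sym; trans to ∼-trans; *-cong to ∼-*)

  infix 4 _∼_
  _∼_ : Carrier → Carrier → Set ℓ
  _∼_ = SameCoset K G

  ≈⇒∼ : ∀ {x y} → x ≈ y → x ∼ y
  ≈⇒∼ {x} {y} x≈y = 1# , Subgroup.1∈ G , trans x≈y (sym (*-identityˡ y))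

  ∼0⇒≈0 : ∀ {x} → x ∼ 0# → x ≈ 0#
  ∼0⇒≈0 (g , _ , x≈g0) = trans x≈g0 (zeroʳ g)

module Quotient {ℓ} (K : Field ℓ) (G : Subgroup K) (_≟0 : ∀ x → Dec (Field._≈_ K x (Field.0# K))) where
  open Field K
  open Subgroup G
  open FieldProperties K
  open RingProperties ring using (-‿distribʳ-*)
  open AbelianGroupProperties +-abelianGroup using (xyx⁻¹≈y; inverseʳ-unique)
  open SetoidReasoning setoid
  open Cosets K G public

  scale : ∀ {g x} → member g → g * x ∼ x
  scale g∈ = _ , g∈ , refl

  -- The language has a total inverse with 0⁻¹ = 0; deciding whether x is zero makes it definable
  -- from `inverse`.
  inv : Carrier → Carrier
  inv x with x ≟0
  ... | yes _  = 0#
  ... | no x≉0 = proj₁ (inverse x x≉0)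

  inv-0 : ∀ {x} → x ≈ 0# → inv x ≈ 0#
  inv-0 {x} x≈0 with x ≟0
  ... | yes _  = refl
  ... | no x≉0 = contradiction x≈0 x≉0

  inv-inverse : ∀ {x} → ¬ x ≈ 0# → x * inv x ≈ 1#
  inv-inverse {x} x≉0 with x ≟0
  ... | yes x≈0 = contradiction x≈0 x≉0
  ... | no x≉0  = proj₂ (inverse x x≉0)

  inv-nonzero : ∀ {x} → ¬ x ≈ 0# → ¬ inv x ≈ 0#
  inv-nonzero x≉0 = factorʳ≉0 (1≉0 ∘ trans (sym (inv-inverse x≉0)))

  -∼ : ∀ {x y} → x ∼ y → - x ∼ - y
  -∼ {x} {y} (g , g∈ , x≈gy) = g , g∈ , trans (-‿cong x≈gy) (-‿distribʳ-* g y)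

  inv-∼ : ∀ {x y} → x ∼ y → inv x ∼ inv y
  inv-∼ {x} {y} x∼y with y ≟0
  ... | yes y≈0 = ≈⇒∼ (inv-0 (∼0⇒≈0 (∼-trans x∼y (≈⇒∼ y≈0))))
  ... | no y≉0  = ∼-trans (≈⇒∼ (sym (trans (*-congˡ y⁻¹y) (*-identityʳ _))))
    (∼-trans (∼-* (∼-refl {inv x}) (∼-* (∼-refl {y⁻¹}) (∼-sym x∼y))) (≈⇒∼ (begin
      inv x * (y⁻¹ * x)   ≈⟨ x∙yz≈y∙zx _ _ _ ⟩
      y⁻¹ * (x * inv x)   ≈⟨ *-congˡ (inv-inverse x≉0) ⟩
      y⁻¹ * 1#            ≈⟨ *-identityʳ _ ⟩
      y⁻¹                 ∎)))
    where
    open CommSemigroup *-commutativeSemigroup using (x∙yz≈y∙zx)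
    y⁻¹ = proj₁ (inverse y y≉0)
    y⁻¹y = trans (*-comm y⁻¹ y) (proj₂ (inverse y y≉0))
    x≉0 : ¬ x ≈ 0#
    x≉0 x≈0 = y≉0 (∼0⇒≈0 (∼-trans (∼-sym x∼y) (≈⇒∼ x≈0)))

  structure : LStructure ℓ
  structure = record
    { reduct = K / G ; -_ = -_ ; _⁻¹ = inv ; -‿cong = -∼ ; ⁻¹-cong = inv-∼ }

  isHyperfield : IsHyperfield structure
  isHyperfield = record
    { 1≉0 = 1≉0 ∘ ∼0⇒≈0
    ; *-nonzero = λ x≁0 y≁0 → *-nonzero (x≁0 ∘ ≈⇒∼) (y≁0 ∘ ≈⇒∼) ∘ ∼0⇒≈0
    ; ⁻¹-nonzero = λ x≁0 → inv-nonzero (x≁0 ∘ ≈⇒∼) ∘ ∼0⇒≈0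
    ; *-isAbelianGroup = record
      { isGroup = record
        { isMonoid = record
          { isSemigroup = record
            { isMagma = record
              { isEquivalence = record { refl = ∼-refl ; sym = ∼-sym ; trans = ∼-trans }
              ; ∙-cong = ∼-* }
            ; assoc = λ _ _ _ → ≈⇒∼ (*-assoc _ _ _) }
          ; identity = (λ _ → ≈⇒∼ (*-identityˡ _)) , (λ _ → ≈⇒∼ (*-identityʳ _)) }
        ; inverse = (λ (x , x≁0) → ≈⇒∼ (trans (*-comm _ _) (inv-inverse (x≁0 ∘ ≈⇒∼))))
                  , (λ (x , x≁0) → ≈⇒∼ (inv-inverse (x≁0 ∘ ≈⇒∼)))
        ; ⁻¹-cong = inv-∼ }
      ; comm = λ _ _ → ≈⇒∼ (*-comm _ _) }
    ; 0⁻¹≈0 = ≈⇒∼ (inv-0 refl)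
    ; *-zeroʳ = ≈⇒∼ ∘ zeroʳ
    ; *-zeroˡ = ≈⇒∼ ∘ zeroˡ
    ; +-nonempty = λ x y → x + y , x , y , ∼-refl , ∼-refl , ∼-refl
    ; +-comm = λ x y → flip-sum , flip-sum
    -- If w₁ = g (x₁ + y₁) with g in G, then g is absorbed into the representatives x₁ and y₁, and
    -- associativity in K applies. The converse is alike.
    ; +-assoc = λ x y z →
        (λ { (w , z′ , (x₁ , y₁ , x₁∼ , y₁∼ , w∼) , z′∼ , (w₁ , z₁ , w₁∼ , z₁∼ , v∼)) →
          let (g , g∈ , w₁≈) = ∼-trans w₁∼ w∼ in
          x , g * y₁ + z₁ , ∼-refl , (g * y₁ , z₁ , ∼-trans (scale g∈) y₁∼ , ∼-trans z₁∼ z′∼ , ∼-refl) ,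
          (g * x₁ , g * y₁ + z₁ , ∼-trans (scale g∈) x₁∼ , ∼-refl ,
           ∼-trans v∼ (≈⇒∼ (trans (+-congʳ (trans w₁≈ (distribˡ g x₁ y₁))) (+-assoc _ _ _)))) }) ,
        (λ { (x′ , w , x′∼ , (y₁ , z₁ , y₁∼ , z₁∼ , w∼) , (x₁ , w₁ , x₁∼ , w₁∼ , v∼)) →
          let (g , g∈ , w₁≈) = ∼-trans w₁∼ w∼ in
          x₁ + g * y₁ , z , (x₁ , g * y₁ , ∼-trans x₁∼ x′∼ , ∼-trans (scale g∈) y₁∼ , ∼-refl) , ∼-refl ,
          (x₁ + g * y₁ , g * z₁ , ∼-refl , ∼-trans (scale g∈) z₁∼ ,
           ∼-trans v∼ (≈⇒∼ (trans (+-congˡ (trans w₁≈ (distribˡ g y₁ z₁))) (sym (+-assoc _ _ _))))) })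
    ; -‿inverse = λ x → x , - x , ∼-refl , ∼-refl , ≈⇒∼ (sym (-‿inverseʳ x))
    ; -‿unique = λ { x y (x₁ , y₁ , x₁∼ , y₁∼ , 0∼) →
        ∼-trans (∼-sym y₁∼) (∼-trans (≈⇒∼ (inverseʳ-unique x₁ y₁ (∼0⇒≈0 (∼-sym 0∼)))) (-∼ x₁∼)) }
    ; reversible = λ { x y z (x₁ , y₁ , x₁∼ , y₁∼ , z∼) →
        x₁ + y₁ , - x₁ , ∼-sym z∼ , -∼ x₁∼ , ∼-trans (∼-sym y₁∼) (≈⇒∼ (sym (xyx⁻¹≈y x₁ y₁))) }
    ; +-identityʳ = λ x →
        (λ { (x₁ , y₁ , x₁∼ , y₁∼ , z∼) →
          ∼-trans z∼ (∼-trans (≈⇒∼ (trans (+-congˡ (∼0⇒≈0 y₁∼)) (+-identityʳ x₁))) x₁∼) }) ,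
        (λ z∼ → x , 0# , ∼-refl , ∼-refl , ∼-trans z∼ (≈⇒∼ (sym (+-identityʳ x))))
    ; distribˡ = λ x y z →
        (λ { (w , (x₁ , y₁ , x₁∼ , y₁∼ , w∼) , v∼) →
          z * x₁ , z * y₁ , ∼-* ∼-refl x₁∼ , ∼-* ∼-refl y₁∼ ,
          ∼-trans v∼ (∼-trans (∼-* ∼-refl w∼) (≈⇒∼ (distribˡ z x₁ y₁))) }) ,
        (λ { (a , b , (g , g∈ , a≈) , (h , h∈ , b≈) , v∼) →
          g * x + h * y , (g * x , h * y , scale g∈ , scale h∈ , ∼-refl) ,
          ∼-trans v∼ (≈⇒∼ (trans (+-cong (trans a≈ (x∙yz≈y∙xz g z x)) (trans b≈ (x∙yz≈y∙xz h z y)))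
            (sym (distribˡ z _ _)))) })
    }
    where
    open CommSemigroup *-commutativeSemigroup using (x∙yz≈y∙xz)
    flip-sum : ∀ {x y z} → CosetSum K G x y z → CosetSum K G y x z
    flip-sum (x₁ , y₁ , x₁∼ , y₁∼ , z∼) = y₁ , x₁ , y₁∼ , x₁∼ , ∼-trans z∼ (≈⇒∼ (+-comm x₁ y₁))

  isKrasner : IsKrasner structure
  isKrasner = isHyperfield , K , G , record
    { to = id ; to-cong = id
    ; bijective = id , (λ y → y , id)
    ; +-homo = λ _ _ _ → mk⇔ id id
    ; *-homo = λ _ _ → ∼-refl ; 0-homo = ∼-refl ; 1-homo = ∼-refl }

-- Characteristic 2 and a tower of Artin-Schreier extensions of F₂.

HasChar2 : ∀ {c ℓ} → CommutativeRing c ℓ → Set ℓ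
HasChar2 R = 1# + 1# ≈ 0#
  where open CommutativeRing R

-- Coefficients in F₂ let the ring solver decide identities valid in characteristic 2.
module Char2Solver {c ℓ} (R : CommutativeRing c ℓ) (2≈0 : HasChar2 R) where
  open CommutativeRing R
  open RingProperties ring using (-0#≈0#)
  open AbelianGroupProperties +-abelianGroup using (inverseʳ-unique)

  bit : Bool → Carrier
  bit true  = 1#
  bit false = 0#

  bit-+ : ∀ x y → bit (x xor y) ≈ bit x + bit y
  bit-+ true  true  = sym 2≈0
  bit-+ true  false = sym (+-identityʳ 1#)
  bit-+ false y     = sym (+-identityˡ _)

  bit-* : ∀ x y → bit (x ∧ y) ≈ bit x * bit y
  bit-* true  y = sym (*-identityˡ _)
  bit-* false y = sym (zeroˡ _)

  bit-neg : ∀ x → bit x ≈ - bit x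
  bit-neg true  = inverseʳ-unique _ _ 2≈0
  bit-neg false = sym -0#≈0#

  private
    bits : CommutativeRing.rawRing Bool.xor-∧-commutativeRing -Raw-AlmostCommutative⟶ fromCommutativeRing R
    bits = record
      { ⟦_⟧ = bit ; +-homo = bit-+ ; *-homo = bit-* ; -‿homo = bit-neg ; 0-homo = refl ; 1-homo = refl }

    bit≟ : ∀ x y → Maybe (bit x ≈ bit y)
    bit≟ true  true  = just refl
    bit≟ false false = just refl
    bit≟ _     _     = nothing

  open Algebra.Solver.Ring _ _ bits bit≟ public
    using (solve; _:=_; _:+_; _:*_; :-_; con)

  x+x≈0 : ∀ x → x + x ≈ 0#
  x+x≈0 = solve 1 (λ x → x :+ x := con false) refl

  x+y≈0⇒x≈y : ∀ {x y} → x + y ≈ 0# → x ≈ y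
  x+y≈0⇒x≈y {x} {y} eq = trans (solve 2 (λ x y → x := y :+ (x :+ y)) refl x y) (trans (+-congˡ eq) (+-identityʳ y))

  sq : Carrier → Carrier
  sq x = x * x

  sq-cong : ∀ {x y} → x ≈ y → sq x ≈ sq y
  sq-cong p = *-cong p p

  sq-+ : ∀ x y → sq (x + y) ≈ sq x + sq y
  sq-+ = solve 2 (λ x y → (x :+ y) :* (x :+ y) := x :* x :+ y :* y) refl

  -- The power x ^ 2 ^ n, that is, the n-fold Frobenius map.
  sq^ : ℕ → Carrier → Carrier
  sq^ zero    x = x
  sq^ (suc n) x = sq (sq^ n x)

  sq^-cong : ∀ n {x y} → x ≈ y → sq^ n x ≈ sq^ n y
  sq^-cong zero    p = p
  sq^-cong (suc n) p = sq-cong (sq^-cong n p)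

  sq^-homo-+ : ∀ m n x → sq^ (m ℕ.+ n) x ≡ sq^ m (sq^ n x)
  sq^-homo-+ zero    n x = ≡.refl
  sq^-homo-+ (suc m) n x = ≡.cong sq (sq^-homo-+ m n x)

  -- The sum x + x² + x⁴ + ... of n terms, which is the trace to F₂ on a field with 2 ^ n elements.
  trace : ℕ → Carrier → Carrier
  trace zero    x = 0#
  trace (suc n) x = sq (trace n x) + x

  trace-cong : ∀ n {x y} → x ≈ y → trace n x ≈ trace n y
  trace-cong zero    p = refl
  trace-cong (suc n) p = +-cong (sq-cong (trace-cong n p)) p

  trace-homo-+ : ∀ m n x → trace (m ℕ.+ n) x ≈ sq^ m (trace n x) + trace m x
  trace-homo-+ zero    n x = sym (+-identityʳ _)
  trace-homo-+ (suc m) n x = trans (+-congʳ (trans (sq-cong (trace-homo-+ m n x)) (sq-+ _ _))) (+-assoc _ _ _)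

  -- The sum (x² + x) + (x⁴ + x²) + ... telescopes.
  trace-artinSchreier : ∀ n x → trace n (sq x + x) ≈ sq^ n x + x
  trace-artinSchreier zero    x = sym (x+x≈0 x)
  trace-artinSchreier (suc n) x = trans (+-congʳ (sq-cong (trace-artinSchreier n x)))
    (solve 2 (λ y x → (y :+ x) :* (y :+ x) :+ (x :* x :+ x) := y :* y :+ x) refl (sq^ n x) x)

-- R[α] with α² = α + a; the pair (p , r) is p + r α.
module Quadratic {c ℓ} (R : CommutativeRing c ℓ) (2≈0 : HasChar2 R) (a : CommutativeRing.Carrier R) where
  open CommutativeRing R
  open Char2Solver R 2≈0

  infixl 7 _⊗_
  _⊗_ : Carrier × Carrier → Carrier × Carrier → Carrier × Carrier
  (p , r) ⊗ (p′ , r′) = p * p′ + a * (r * r′) , p * r′ + r * p′ + r * r′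

  ring₂ : CommutativeRing c ℓ
  ring₂ = record
    { Carrier = Carrier × Carrier
    ; _≈_ = λ (p , r) (p′ , r′) → p ≈ p′ × r ≈ r′
    ; _+_ = λ (p , r) (p′ , r′) → p + p′ , r + r′
    ; _*_ = _⊗_
    ; -_ = λ (p , r) → - p , - r
    ; 0# = 0# , 0#
    ; 1# = 1# , 0#
    ; isCommutativeRing = record
      { isRing = record
        { +-isAbelianGroup = record
          { isGroup = record
            { isMonoid = record
              { isSemigroup = record
                { isMagma = record
                  { isEquivalence = record
                    { refl = refl , refl
                    ; sym = λ (p , q) → sym p , sym q
                    ; trans = λ (p , q) (p′ , q′) → trans p p′ , trans q q′ }
                  ; ∙-cong = λ (p , q) (p′ , q′) → +-cong p p′ , +-cong q q′ }
                ; assoc = λ _ _ _ → +-assoc _ _ _ , +-assoc _ _ _ }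
              ; identity = (λ _ → +-identityˡ _ , +-identityˡ _) , (λ _ → +-identityʳ _ , +-identityʳ _) }
            ; inverse = (λ _ → -‿inverseˡ _ , -‿inverseˡ _) , (λ _ → -‿inverseʳ _ , -‿inverseʳ _)
            ; ⁻¹-cong = λ (p , q) → -‿cong p , -‿cong q }
          ; comm = λ _ _ → +-comm _ _ , +-comm _ _ }
        ; *-cong = λ (p , q) (p′ , q′) →
            +-cong (*-cong p p′) (*-congˡ (*-cong q q′)) ,
            +-cong (+-cong (*-cong p q′) (*-cong q p′)) (*-cong q q′)
        ; *-assoc = λ (p , r) (p′ , r′) (p″ , r″) →
            solve 7 (λ a p r p′ r′ p″ r″ →
              (p :* p′ :+ a :* (r :* r′)) :* p″ :+ a :* ((p :* r′ :+ r :* p′ :+ r :* r′) :* r″) :=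
              p :* (p′ :* p″ :+ a :* (r′ :* r″)) :+ a :* (r :* (p′ :* r″ :+ r′ :* p″ :+ r′ :* r″)))
              refl a p r p′ r′ p″ r″ ,
            solve 7 (λ a p r p′ r′ p″ r″ →
              (p :* p′ :+ a :* (r :* r′)) :* r″ :+ (p :* r′ :+ r :* p′ :+ r :* r′) :* p″ :+
                (p :* r′ :+ r :* p′ :+ r :* r′) :* r″ :=
              p :* (p′ :* r″ :+ r′ :* p″ :+ r′ :* r″) :+ r :* (p′ :* p″ :+ a :* (r′ :* r″)) :+
                r :* (p′ :* r″ :+ r′ :* p″ :+ r′ :* r″))
              refl a p r p′ r′ p″ r″
        ; *-identity = (λ x → ⊗-identityˡ x) ,
            (λ x → trans (proj₁ (⊗-comm x (1# , 0#))) (proj₁ (⊗-identityˡ x)) ,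
                   trans (proj₂ (⊗-comm x (1# , 0#))) (proj₂ (⊗-identityˡ x)))
        ; distrib = ⊗-distribˡ , (λ x y z →
            trans (proj₁ (⊗-comm (y +₂ z) x)) (trans (proj₁ (⊗-distribˡ x y z))
              (+-cong (proj₁ (⊗-comm x y)) (proj₁ (⊗-comm x z)))) ,
            trans (proj₂ (⊗-comm (y +₂ z) x)) (trans (proj₂ (⊗-distribˡ x y z))
              (+-cong (proj₂ (⊗-comm x y)) (proj₂ (⊗-comm x z))))) }
      ; *-comm = ⊗-comm } }
    where
    _+₂_ : Carrier × Carrier → Carrier × Carrier → Carrier × Carrier
    (p , r) +₂ (p′ , r′) = p + p′ , r + r′
    _≈₂_ : Carrier × Carrier → Carrier × Carrier → Set ℓ
    (p , r) ≈₂ (p′ , r′) = p ≈ p′ × r ≈ r′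
    ⊗-comm : ∀ x y → (x ⊗ y) ≈₂ (y ⊗ x)
    ⊗-comm (p , r) (p′ , r′) =
      solve 5 (λ a p r p′ r′ → p :* p′ :+ a :* (r :* r′) := p′ :* p :+ a :* (r′ :* r)) refl a p r p′ r′ ,
      solve 4 (λ p r p′ r′ → p :* r′ :+ r :* p′ :+ r :* r′ := p′ :* r :+ r′ :* p :+ r′ :* r) refl p r p′ r′
    ⊗-identityˡ : ∀ x → ((1# , 0#) ⊗ x) ≈₂ x
    ⊗-identityˡ (p , r) =
      solve 3 (λ a p r → con true :* p :+ a :* (con false :* r) := p) refl a p r ,
      solve 2 (λ p r → con true :* r :+ con false :* p :+ con false :* r := r) refl p r
    ⊗-distribˡ : ∀ x y z → (x ⊗ (y +₂ z)) ≈₂ ((x ⊗ y) +₂ (x ⊗ z))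
    ⊗-distribˡ (p , r) (p′ , r′) (p″ , r″) =
      solve 7 (λ a p r p′ r′ p″ r″ →
        p :* (p′ :+ p″) :+ a :* (r :* (r′ :+ r″)) :=
        (p :* p′ :+ a :* (r :* r′)) :+ (p :* p″ :+ a :* (r :* r″))) refl a p r p′ r′ p″ r″ ,
      solve 6 (λ p r p′ r′ p″ r″ →
        p :* (r′ :+ r″) :+ r :* (p′ :+ p″) :+ r :* (r′ :+ r″) :=
        (p :* r′ :+ r :* p′ :+ r :* r′) :+ (p :* r″ :+ r :* p″ :+ r :* r″)) refl p r p′ r′ p″ r″

-- The field with 2 ^ 2 ^ j elements, with a of trace 1 over F₂, so that α² + α = a is irreducible.
record Stage (ℓ : Level) (j : ℕ) : Set (Level.suc ℓ) where
  field
    field₀ : Field ℓ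
  open Field field₀
  field
    _≟0  : ∀ x → Dec (x ≈ 0#)
    2≈0  : 1# + 1# ≈ 0#
    a    : Carrier
  open Char2Solver commutativeRing 2≈0
  field
    frobenius : ∀ x → sq^ (2 ^ j) x ≈ x
    trace-a   : trace (2 ^ j) a ≈ 1#

module Extension {ℓ j} (S : Stage ℓ j) where
  open Stage S
  open Field field₀
  open Char2Solver commutativeRing 2≈0
  open FieldProperties field₀
  private
    q : ℕ
    q = 2 ^ j
    ring₂ᴱ = Quadratic.ring₂ commutativeRing 2≈0 a
    module E = CommutativeRing ring₂ᴱ

  2≈0ᴱ : E.1# E.+ E.1# E.≈ E.0#
  2≈0ᴱ = 2≈0 , +-identityʳ 0#

  private module Eᶜ = Char2Solver ring₂ᴱ 2≈0ᴱ

  -- By telescoping and `frobenius` the trace of x² + x is x + x = 0, whereas a has trace 1.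
  irreducible : ∀ x → ¬ sq x + x ≈ a
  irreducible x eq = 1≉0 (begin
    1#                   ≈⟨ trace-a ⟨
    trace q a            ≈⟨ trace-cong q eq ⟨
    trace q (sq x + x)   ≈⟨ trace-artinSchreier q x ⟩
    sq^ q x + x          ≈⟨ +-congʳ (frobenius x) ⟩
    x + x                ≈⟨ x+x≈0 x ⟩
    0#                   ∎)
    where open SetoidReasoning setoid

  -- The product of p + r α with its conjugate (p + r) + r α.
  norm : E.Carrier → Carrier
  norm (p , r) = sq p + p * r + a * sq r

  -- For r ≠ 0 a vanishing norm would make p / r a root of T² + T = a.
  norm≈0⇒≈0 : ∀ x → norm x ≈ 0# → x E.≈ E.0#
  norm≈0⇒≈0 (p , r) N≈0 with r ≟0
  ... | yes r≈0 = decidable-stable (p ≟0) (λ p≉0 → p≉0 (xy≈0⇒y≈0 p≉0 (begin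
      p * p                        ≈⟨ solve 2 (λ a p →
        p :* p := p :* p :+ p :* con false :+ a :* (con false :* con false)) refl a p ⟩
      sq p + p * 0# + a * sq 0#    ≈⟨ +-cong (+-congˡ (*-congˡ r≈0)) (*-congˡ (sq-cong r≈0)) ⟨
      norm (p , r)                 ≈⟨ N≈0 ⟩
      0#                           ∎))) , r≈0
    where open SetoidReasoning setoid
  ... | no r≉0 with s , rs≈1 ← inverse r r≉0 = contradiction (begin
      sq (p * s) + p * s                                     ≈⟨ solve 4 (λ a p r s →
        p :* s :* (p :* s) :+ p :* s :=
        s :* s :* (p :* p :+ p :* r :+ a :* (r :* r)) :+ a :* (r :* s :* (r :* s)) :+ p :* s :* (r :* s :+ con true)) refl a p r s ⟩
      s * s * norm (p , r) + a * sq (r * s) + p * s * (r * s + 1#)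
        ≈⟨ +-cong (+-cong (*-congˡ N≈0) (*-congˡ (sq-cong rs≈1))) (*-congˡ (+-congʳ rs≈1)) ⟩
      s * s * 0# + a * sq 1# + p * s * (1# + 1#)             ≈⟨ solve 3 (λ a p s →
        s :* s :* con false :+ a :* (con true :* con true) :+ p :* s :* (con true :+ con true) := a) refl a p s ⟩
      a                                                      ∎) (irreducible (p * s))
    where open SetoidReasoning setoid

  _≟0ᴱ : ∀ x → Dec (x E.≈ E.0#)
  (p , r) ≟0ᴱ = (p ≟0) ×-dec (r ≟0)

  extension : Field ℓ
  extension = record
    { commutativeRing = ring₂ᴱ
    ; 1≉0 = 1≉0 ∘ proj₁
    ; inverse = invert }
    where
    invert : ∀ x → ¬ x E.≈ E.0# → ∃ λ y → x E.* y E.≈ E.1#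
    invert x@(p , r) x≉0 with i , Ni≈1 ← inverse (norm x) (x≉0 ∘ norm≈0⇒≈0 x) =
      ((p + r) * i , r * i) ,
      trans (solve 4 (λ a p r i →
        p :* ((p :+ r) :* i) :+ a :* (r :* (r :* i)) := (p :* p :+ p :* r :+ a :* (r :* r)) :* i) refl a p r i) Ni≈1 ,
      solve 3 (λ p r i → p :* (r :* i) :+ r :* ((p :+ r) :* i) :+ r :* (r :* i) := con false) refl p r i

  generator : ∃ λ c → ¬ c E.≈ E.0# × ¬ c E.≈ E.1#
  generator = (0# , 1#) , 1≉0 ∘ proj₂ , 1≉0 ∘ proj₂

  -- Repeated squaring of α² = α + a gives α ^ 2 ^ n = α + `trace n a`.
  sq^-pair : ∀ n p r → Eᶜ.sq^ n (p , r) E.≈ (sq^ n p + sq^ n r * trace n a , sq^ n r)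
  sq^-pair zero    p r = solve 2 (λ p r → p := p :+ r :* con false) refl p r , refl
  sq^-pair (suc n) p r with eq₁ , eq₂ ← sq^-pair n p r =
    trans (+-cong (sq-cong eq₁) (*-congˡ (sq-cong eq₂)))
      (solve 4 (λ a P R T →
        (P :+ R :* T) :* (P :+ R :* T) :+ a :* (R :* R) := P :* P :+ R :* R :* (T :* T :+ a))
        refl a (sq^ n p) (sq^ n r) (trace n a)) ,
    trans (+-cong (+-cong (*-cong eq₁ eq₂) (*-cong eq₂ eq₁)) (sq-cong eq₂))
      (solve 2 (λ X R → X :* R :+ R :* X :+ R :* R := R :* R) refl (sq^ n p + sq^ n r * trace n a) (sq^ n r))

  -- As a has trace 1, the Frobenius map of the lower field sends α to α + 1.
  frobenius-conj : ∀ p r → Eᶜ.sq^ q (p , r) E.≈ (p + r , r)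
  frobenius-conj p r with eq₁ , eq₂ ← sq^-pair q p r =
    trans eq₁ (+-cong (frobenius p) (trans (*-cong (frobenius r) trace-a) (*-identityʳ r))) , trans eq₂ (frobenius r)

  -- The element a α. Its trace to the lower field is a α + a (α + 1) = a, so its trace to F₂ is
  -- again 1 and the tower continues.
  a⁺ : E.Carrier
  a⁺ = 0# , a

  trace-a⁺₂ : ∀ n → proj₂ (Eᶜ.trace n a⁺) ≈ trace n a
  trace-a⁺₂ zero    = refl
  trace-a⁺₂ (suc n) = +-congʳ (trans
    (solve 2 (λ u v → u :* v :+ v :* u :+ v :* v := v :* v) refl _ _) (sq-cong (trace-a⁺₂ n)))

  next : Stage ℓ (suc j)
  next = record
    { field₀ = extension
    ; _≟0 = _≟0ᴱ
    ; 2≈0 = 2≈0ᴱ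
    ; a = a⁺
    ; frobenius = λ x@(p , r) → E.trans
        (E.reflexive (≡.trans (≡.cong (λ n → Eᶜ.sq^ (q ℕ.+ n) x) (ℕ.+-identityʳ q)) (Eᶜ.sq^-homo-+ q q x)))
        (E.trans (Eᶜ.sq^-cong q (frobenius-conj p r)) (E.trans (frobenius-conj (p + r) r)
          (solve 2 (λ p r → p :+ r :+ r := p) refl p r , refl)))
    -- The trace is the partial sum (u , v) plus its conjugate (u + v , v), that is (v , 0), where v
    -- is the trace of a.
    ; trace-a = let (u , v) = Eᶜ.trace q a⁺ in
        E.trans (E.reflexive (≡.cong (λ n → Eᶜ.trace (q ℕ.+ n) a⁺) (ℕ.+-identityʳ q)))
        (E.trans (Eᶜ.trace-homo-+ q q a⁺) (E.trans (E.+-congʳ (frobenius-conj u v))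
          (trans (solve 2 (λ u v → u :+ v :+ u := v) refl u v) (trans (trace-a⁺₂ q) trace-a) , x+x≈0 v))) }

liftRing : ∀ ℓ → CommutativeRing 0ℓ 0ℓ → CommutativeRing ℓ ℓ
liftRing ℓ R = record
  { isCommutativeRing = RingMonomorphism.isCommutativeRing {R₁ = lifted} {R₂ = R.rawRing} {⟦_⟧ = lower} (record
    { isRingHomomorphism = record
      { isSemiringHomomorphism = record
        { isNearSemiringHomomorphism = record
          { +-isMonoidHomomorphism = record
            { isMagmaHomomorphism = record
              { isRelHomomorphism = record { cong = lower }
              ; homo = λ _ _ → R.refl }
            ; ε-homo = R.refl }
          ; *-homo = λ _ _ → R.refl }
        ; 1#-homo = R.refl }
      ; -‿homo = λ _ → R.refl }
    ; injective = lift }) R.isCommutativeRing }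
  where
  module R = CommutativeRing R
  lifted : RawRing ℓ ℓ
  lifted = record
    { Carrier = Lift ℓ R.Carrier
    ; _≈_ = λ (lift x) (lift y) → Lift ℓ (x R.≈ y)
    ; _+_ = λ (lift x) (lift y) → lift (x R.+ y)
    ; _*_ = λ (lift x) (lift y) → lift (x R.* y)
    ; -_ = λ (lift x) → lift (R.- x)
    ; 0# = lift R.0#
    ; 1# = lift R.1# }

stage : ∀ {ℓ} j → Stage ℓ j
stage {ℓ} zero = record
  { field₀ = record
    { commutativeRing = liftRing ℓ Bool.xor-∧-commutativeRing
    ; 1≉0 = λ ()
    ; inverse = λ { (lift true) _ → lift true , lift ≡.refl ; (lift false) x≉0 → contradiction (lift ≡.refl) x≉0 } }
  ; _≟0 = λ { (lift true) → no λ () ; (lift false) → yes (lift ≡.refl) }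
  ; 2≈0 = lift ≡.refl
  ; a = lift true
  ; frobenius = λ { (lift true) → lift ≡.refl ; (lift false) → lift ≡.refl }
  ; trace-a = lift ≡.refl }
stage (suc j) = Extension.next (stage j)

-- Small numbers are prime to Fermat numbers.

twoTower : ℕ → ℕ
twoTower i = 2 ^ 2 ^ i

twoTower-suc : ∀ i → twoTower (suc i) ≡ twoTower i ℕ.* twoTower i
twoTower-suc i = ≡.trans (≡.cong (λ n → 2 ^ (2 ^ i ℕ.+ n)) (ℕ.+-identityʳ (2 ^ i))) (ℕ.^-distribˡ-+-* 2 (2 ^ i) (2 ^ i))

-- Modulo a divisor d of the Fermat number 2 ^ 2 ^ j + 1 the iterated squares of 2 reach -1 at step j and
-- are 1 afterwards, so the first j + 1 of them are distinct unless -1 = 1.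
small-divisor-fermat : ∀ {d} j → d ≤ j → d ∣ suc (twoTower j) → d ≡ 1
small-divisor-fermat {zero} j _ 0∣ with () ← 0∣⇒≡0 0∣
small-divisor-fermat {d@(suc _)} j d≤j d∣F
  with a , b , a<b , eq ← Fin.pigeonhole (s≤s d≤j) (λ (i : Fin (suc j)) → twoTower (toℕ i) mod d)
  = ∣1⇒≡1 (∣m+n∣m⇒∣n (≡.subst (d ∣_) (ℕ.+-comm 1 _) d∣F) (∣-trans d∣2 (2∣twoTower j)))
  where
  2∣twoTower : ∀ j → 2 ∣ twoTower j
  2∣twoTower j with 2 ^ j | ℕ.m^n>0 2 j
  ... | suc k | _ = m∣m*n (2 ^ k)

  _≋_ : ℕ → ℕ → Set
  u ≋ v = u % d ≡ v % d

  ≋-suc : ∀ {u v} → u ≋ v → suc u ≋ suc v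
  ≋-suc {u} {v} p = ≡.trans (%-distribˡ-+ 1 u d) (≡.trans (≡.cong (λ w → (1 % d ℕ.+ w) % d) p) (≡.sym (%-distribˡ-+ 1 v d)))

  ≋-twoTower : ∀ {i k} t → twoTower i ≋ twoTower k → twoTower (t ℕ.+ i) ≋ twoTower (t ℕ.+ k)
  ≋-twoTower zero p = p
  ≋-twoTower {i} {k} (suc t) p = begin
    twoTower (suc t ℕ.+ i) % d              ≡⟨ ≡.cong (_% d) (twoTower-suc (t ℕ.+ i)) ⟩
    (x ℕ.* x) % d                           ≡⟨ %-distribˡ-* x x d ⟩
    ((x % d) ℕ.* (x % d)) % d               ≡⟨ ≡.cong (λ w → (w ℕ.* w) % d) (≋-twoTower t p) ⟩
    ((y % d) ℕ.* (y % d)) % d               ≡⟨ %-distribˡ-* y y d ⟨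
    (y ℕ.* y) % d                           ≡⟨ ≡.cong (_% d) (twoTower-suc (t ℕ.+ k)) ⟨
    twoTower (suc t ℕ.+ k) % d              ∎
    where
    open ≡.≡-Reasoning
    x = twoTower (t ℕ.+ i)
    y = twoTower (t ℕ.+ k)

  IsOne : ℕ → Set
  IsOne x = ∃ λ m → x ≡ suc m × d ∣ m

  isOne-twoTower : ∀ {i} t → IsOne (twoTower i) → IsOne (twoTower (t ℕ.+ i))
  isOne-twoTower zero    one = one
  isOne-twoTower {i} (suc t) one with m , x≡ , d∣m ← isOne-twoTower t one =
    m ℕ.+ m ℕ.* suc m , ≡.trans (twoTower-suc (t ℕ.+ i)) (≡.cong (λ x → x ℕ.* x) x≡) ,
    ≡.subst (d ∣_) (ℕ.*-suc m (suc m)) (∣m⇒∣m*n (suc (suc m)) d∣m)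

  -- If x = -1 then x² = 1.
  isOne-square : ∀ i → d ∣ suc (twoTower i) → IsOne (twoTower (suc i))
  isOne-square i d∣ with twoTower i | ℕ.m^n>0 2 (2 ^ i) | twoTower-suc i
  ... | suc w | _ | x²≡ = w ℕ.+ w ℕ.* suc w , x²≡ , ≡.subst (d ∣_) (ℕ.*-suc w (suc w)) (∣n⇒∣m*n w d∣)

  t = j ℕ.∸ toℕ b
  t+b≡j = ℕ.m∸n+n≡m (ℕ.≤-pred (Fin.toℕ<n b))

  -- Squaring t more times moves the coincidence at a < b to one at c < j. So 2 ^ 2 ^ c is already
  -- -1, whence 2 ^ 2 ^ j is 1 as well as -1, and d divides 2.
  c = t ℕ.+ toℕ a
  c<j : c < j
  c<j = ≡.subst (c <_) t+b≡j (ℕ.+-monoʳ-< t a<b)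

  twoTower-c≋ : twoTower c ≋ twoTower j
  twoTower-c≋ = ≡.subst (λ k → twoTower c ≋ twoTower k) t+b≡j (≋-twoTower t
    (≡.trans (≡.sym (Fin.toℕ-fromℕ< _)) (≡.trans (≡.cong toℕ eq) (Fin.toℕ-fromℕ< _))))

  d∣suc-c : d ∣ suc (twoTower c)
  d∣suc-c = m%n≡0⇒n∣m _ d (≡.trans (≋-suc twoTower-c≋) (n∣m⇒m%n≡0 _ d d∣F))

  twoTower-j-one : IsOne (twoTower j)
  twoTower-j-one = ≡.subst (IsOne ∘ twoTower) (ℕ.m∸n+n≡m c<j) (isOne-twoTower (j ℕ.∸ suc c) (isOne-square c d∣suc-c))

  d∣2 : d ∣ 2
  d∣2 with m , x≡ , d∣m ← twoTower-j-one =
    ∣m+n∣m⇒∣n (≡.subst (d ∣_) (≡.trans (≡.cong suc x≡) (ℕ.+-comm 2 m)) d∣F) d∣m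

fermat-coprime : ∀ {m j} → suc m ≤ j → Coprime (suc m) (suc (twoTower j))
fermat-coprime m<j (d∣m , d∣F) = small-divisor-fermat _ (ℕ.≤-trans (∣⇒≤ d∣m) m<j) d∣F

-- Groups of finite exponent, and quotients by a quadratic subfield.

module _ {a ℓ} (A : AbelianGroup a ℓ) where
  open Combinations A
  open SetoidReasoning setoid

  -- A Bézout identity between m and F makes multiplication by m invertible on a group killed by F.
  -- The two signs of the identity are separate cases, since the coefficients are natural numbers.
  exponent⇒good : ∀ {N F} → (∀ x → F · x ≈ ε) → (∀ m → m < N → Coprime (suc m) F) →
                  (∃ λ g → ¬ g ≈ ε) → Good N
  exponent⇒good {N} {F} F-kills coprime nontrivial = record
    { ·-cancel = λ m m<N {x} {y} eq → cancel (suc m) (coprime-Bézout (coprime m m<N)) eq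
    ; divide = λ m m<N x → divide (suc m) (coprime-Bézout (coprime m m<N)) x
    ; nontrivial = nontrivial }
    where
    kF-kills : ∀ k x → (k ℕ.* F) · x ≈ ε
    kF-kills k x = trans (sym (×-assocˡ x k F)) (trans (×-congʳ k (F-kills x)) (·-ε k))

    cancel : ∀ m → Bézout.Identity 1 m F → ∀ {x y} → m · x ≈ m · y → x ≈ y
    cancel m (Bézout.+- k l eq) {x} {y} mx≈my = begin
      x              ≈⟨ kmx≈x x ⟨
      k · m · x      ≈⟨ ×-congʳ k mx≈my ⟩
      k · m · y      ≈⟨ kmx≈x y ⟩
      y              ∎
      where
      kmx≈x : ∀ x → k · m · x ≈ x
      kmx≈x x = trans (×-assocˡ x k m) (trans (×-congˡ (≡.sym eq)) (trans (∙-congˡ (kF-kills l x)) (identityʳ x)))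
    cancel m (Bézout.-+ k l eq) {x} {y} mx≈my = ∙-cancelʳ (k · m · x) x y
      (trans (x+kmx≈ε x) (trans (sym (x+kmx≈ε y)) (∙-congˡ (×-congʳ k (sym mx≈my)))))
      where
      x+kmx≈ε : ∀ x → x ∙ k · m · x ≈ ε
      x+kmx≈ε x = trans (∙-congˡ (×-assocˡ x k m)) (trans (×-congˡ eq) (kF-kills l x))

    divide : ∀ m → Bézout.Identity 1 m F → ∀ x → ∃ λ y → m · y ≈ x
    divide m (Bézout.+- k l eq) x = k · x , trans (×-assocˡ x m k) (trans (×-congˡ (≡.trans (ℕ.*-comm m k) (≡.sym eq)))
      (trans (∙-congˡ (kF-kills l x)) (identityʳ x)))
    divide m (Bézout.-+ k l eq) x = k · (x ⁻¹) , trans (×-assocˡ (x ⁻¹) m k) (∙-cancelˡ (x ⁻¹) _ _ (begin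
      x ⁻¹ ∙ (m ℕ.* k) · (x ⁻¹)    ≈⟨ ×-congˡ {x ⁻¹} (≡.trans (≡.cong suc (ℕ.*-comm m k)) eq) ⟩
      (l ℕ.* F) · (x ⁻¹)           ≈⟨ kF-kills l (x ⁻¹) ⟩
      ε                            ≈⟨ inverseˡ x ⟨
      x ⁻¹ ∙ x                     ∎))

-- The field `combination` expresses degree at most two without a fixed basis: 1 and any w outside
-- the base span E.
record QuadraticSubfield {ℓ} (E : Field ℓ) : Set (Level.suc ℓ) where
  open Field E
  field
    InBase      : Carrier → Set ℓ
    InBase?     : ∀ x → Dec (InBase x)
    InBase-resp : ∀ {x y} → x ≈ y → InBase x → InBase y
    InBase-1    : InBase 1#
    InBase-+    : ∀ {x y} → InBase x → InBase y → InBase (x + y)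
    InBase-*    : ∀ {x y} → InBase x → InBase y → InBase (x * y)
    InBase-⁻¹   : ∀ {x y} → InBase x → x * y ≈ 1# → InBase y
    combination : ∀ u w → ¬ InBase w → ∃₂ λ p r → InBase p × InBase r × u ≈ p + r * w

module QuadraticQuotient {ℓ} (E : Field ℓ) (_≟0 : ∀ x → Dec (Field._≈_ E x (Field.0# E)))
                         (2≈0 : HasChar2 (Field.commutativeRing E)) (B : QuadraticSubfield E) where
  open Field E
  open FieldProperties E
  open Char2Solver commutativeRing 2≈0 using (solve; _:=_; _:+_; _:*_; con; x+x≈0; x+y≈0⇒x≈y; sq^)
  open QuadraticSubfield B

  baseUnits : Subgroup E
  baseUnits = record
    { member = λ x → InBase x × ¬ x ≈ 0#
    ; respects = λ x≈y (x-base , x≉0) → InBase-resp x≈y x-base , x≉0 ∘ trans x≈y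
    ; nonzero = proj₂
    ; 1∈ = InBase-1 , 1≉0
    ; *-closed = λ (x-base , x≉0) (y-base , y≉0) → InBase-* x-base y-base , *-nonzero x≉0 y≉0
    ; ⁻¹-closed = λ (x-base , x≉0) xy≈1 → InBase-⁻¹ x-base xy≈1 , factorʳ≉0 (1≉0 ∘ trans (sym xy≈1)) }

  open Quotient E baseUnits _≟0 public
  open Subgroup baseUnits using (member)

  ratio : Carrier → Carrier → Carrier
  ratio x y = x * inv y

  ratio-* : ∀ x {y} → ¬ y ≈ 0# → ratio x y * y ≈ x
  ratio-* x {y} y≉0 = trans (*-assoc x (inv y) y)
    (trans (*-congˡ (trans (*-comm (inv y) y) (inv-inverse y≉0))) (*-identityʳ x))

  ratio-≉0 : ∀ {x y} → ¬ x ≈ 0# → ¬ y ≈ 0# → ¬ ratio x y ≈ 0#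
  ratio-≉0 x≉0 y≉0 = *-nonzero x≉0 (inv-nonzero y≉0)

  InBase-ratio⇒∼ : ∀ {x y} → ¬ x ≈ 0# → ¬ y ≈ 0# → InBase (ratio x y) → x ∼ y
  InBase-ratio⇒∼ {x} {y} x≉0 y≉0 b = ratio x y , (b , ratio-≉0 x≉0 y≉0) , sym (ratio-* x y≉0)

  ∼⇒InBase-ratio : ∀ {x y} → ¬ y ≈ 0# → x ∼ y → InBase (ratio x y)
  ∼⇒InBase-ratio {x} {y} y≉0 (g , (g-base , _) , x≈gy) = InBase-resp
    (sym (trans (*-congʳ x≈gy) (trans (*-assoc g y (inv y)) (trans (*-congˡ (inv-inverse y≉0)) (*-identityʳ g))))) g-base

  _∼?_ : ∀ x y → Dec (x ∼ y)
  x ∼? y with x ≟0 | y ≟0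
  ... | yes x≈0 | yes y≈0 = yes (≈⇒∼ (trans x≈0 (sym y≈0)))
  ... | yes x≈0 | no y≉0  = no (λ x∼y → y≉0 (∼0⇒≈0 (∼-trans (∼-sym x∼y) (≈⇒∼ x≈0))))
  ... | no x≉0  | yes y≈0 = no (λ x∼y → x≉0 (∼0⇒≈0 (∼-trans x∼y (≈⇒∼ y≈0))))
  ... | no x≉0  | no y≉0  = map′ (InBase-ratio⇒∼ x≉0 y≉0) (∼⇒InBase-ratio y≉0) (InBase? (ratio x y))

  same-coset-sum : ∀ {u v w} → u ∼ w → v ∼ w → u + v ∼ 0# ⊎ u + v ∼ w
  same-coset-sum {u} {v} {w} (g , (g-base , _) , u≈gw) (h , (h-base , _) , v≈hw) with (g + h) ≟0
  ... | yes g+h≈0 = inj₁ (≈⇒∼ (trans u+v≈ (trans (*-congʳ g+h≈0) (zeroˡ w))))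
    where u+v≈ = trans (+-cong u≈gw v≈hw) (sym (distribʳ w g h))
  ... | no g+h≉0 = inj₂ (g + h , (InBase-+ g-base h-base , g+h≉0) , trans (+-cong u≈gw v≈hw) (sym (distribʳ w g h)))

  -- In characteristic 2 each of x₁, y₁, x₁ + y₁ is the sum of the other two. If two of them share a
  -- coset, the third is zero or lies in that coset too.
  sum⇒collinear : ∀ x y z → CosetSum E baseUnits x y z → Collinear structure x y z
  sum⇒collinear x y z (x₁ , y₁ , x₁∼x , y₁∼y , z∼) with x ∼? 0# | y ∼? 0# | z ∼? 0# | x ∼? y | y ∼? z | x ∼? z
  ... | yes x∼0 | _ | _ | _ | _ | _ = inj₁ (x∼0 , ∼-sym (∼-trans z∼
          (∼-trans (≈⇒∼ (trans (+-congʳ (∼0⇒≈0 (∼-trans x₁∼x x∼0))) (+-identityˡ y₁))) y₁∼y)))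
  ... | no _ | yes y∼0 | _ | _ | _ | _ = inj₂ (inj₁ (y∼0 , ∼-sym (∼-trans z∼
          (∼-trans (≈⇒∼ (trans (+-congˡ (∼0⇒≈0 (∼-trans y₁∼y y∼0))) (+-identityʳ x₁))) x₁∼x))))
  ... | no _ | no _ | yes z∼0 | _ | _ | _ = inj₂ (inj₂ (inj₁ (z∼0 , ∼-trans (∼-sym x₁∼x)
          (∼-trans (≈⇒∼ (x+y≈0⇒x≈y (∼0⇒≈0 (∼-trans (∼-sym z∼) z∼0)))) y₁∼y))))
  ... | no _ | no _ | no z≁0 | yes x∼y | _ | _ = inj₂ (inj₂ (inj₂ (inj₁ (x∼y ,
          [ (λ 0-sum → contradiction (∼-trans z∼ 0-sum) z≁0) , (λ y-sum → ∼-sym (∼-trans z∼ y-sum)) ]′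
          (same-coset-sum (∼-trans x₁∼x x∼y) y₁∼y)))))
  ... | no x≁0 | no _ | no _ | no x≁y | yes y∼z | _ =
          [ (λ 0-sum → contradiction (∼-trans (∼-sym x₁∼x) (∼-trans (≈⇒∼ x₁≈) 0-sum)) x≁0) ,
            (λ y-sum → contradiction (∼-trans (∼-sym x₁∼x) (∼-trans (≈⇒∼ x₁≈) y-sum)) x≁y) ]′
          (same-coset-sum (∼-trans (∼-sym z∼) (∼-sym y∼z)) y₁∼y)
          where x₁≈ = solve 2 (λ x y → x := x :+ y :+ y) refl x₁ y₁
  ... | no _ | no y≁0 | no _ | no x≁y | no _ | yes x∼z =
          [ (λ 0-sum → contradiction (∼-trans (∼-sym y₁∼y) (∼-trans (≈⇒∼ y₁≈) 0-sum)) y≁0) ,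
            (λ x-sum → contradiction (∼-sym (∼-trans (∼-sym y₁∼y) (∼-trans (≈⇒∼ y₁≈) x-sum))) x≁y) ]′
          (same-coset-sum (∼-trans (∼-sym z∼) (∼-sym x∼z)) x₁∼x)
          where y₁≈ = solve 2 (λ x y → y := x :+ y :+ x) refl x₁ y₁
  ... | no x≁0 | no y≁0 | no z≁0 | no x≁y | no y≁z | no x≁z = inj₂ (inj₂ (inj₂ (inj₂
          (lift ∘ x≁0 , lift ∘ y≁0 , lift ∘ z≁0 , lift ∘ x≁y , lift ∘ y≁z , lift ∘ x≁z))))

  -- Since y / x lies outside the base, z / x = p + r (y / x) with p and r in the base. Neither
  -- vanishes, because z is proportional neither to y nor to x.
  independent⇒sum : ∀ {x y z} → ¬ x ≈ 0# → ¬ y ≈ 0# → ¬ z ≈ 0# → ¬ x ∼ y → ¬ y ∼ z → ¬ x ∼ z →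
                    CosetSum E baseUnits x y z
  independent⇒sum {x} {y} {z} x≉0 y≉0 z≉0 x≁y y≁z x≁z
    with p , r , p-base , r-base , u≈ ← combination (ratio z x) (ratio y x) (x≁y ∘ ∼-sym ∘ InBase-ratio⇒∼ y≉0 x≉0) =
    p * x , r * y , scale (p-base , p≉0) , scale (r-base , r≉0) , ≈⇒∼ z≈
    where
    z≈ : z ≈ p * x + r * y
    z≈ = begin
      z                            ≈⟨ ratio-* z x≉0 ⟨
      ratio z x * x                ≈⟨ *-congʳ u≈ ⟩
      (p + r * ratio y x) * x      ≈⟨ distribʳ x p (r * ratio y x) ⟩
      p * x + r * ratio y x * x    ≈⟨ +-congˡ (trans (*-assoc r (ratio y x) x) (*-congˡ (ratio-* y x≉0))) ⟩
      p * x + r * y                ∎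
      where open SetoidReasoning setoid
    r≉0 : ¬ r ≈ 0#
    r≉0 r≈0 = x≁z (∼-sym (p , (p-base , factorˡ≉0 (z≉0 ∘ trans z≈px)) , z≈px))
      where
      z≈px : z ≈ p * x
      z≈px = trans z≈ (trans (+-congˡ (trans (*-congʳ r≈0) (zeroˡ y))) (+-identityʳ _))
    p≉0 : ¬ p ≈ 0#
    p≉0 p≈0 = y≁z (∼-sym (r , (r-base , r≉0) ,
      trans z≈ (trans (+-congʳ (trans (*-congʳ p≈0) (zeroˡ x))) (+-identityˡ _))))

  open IsHyperfield isHyperfield using (*-isAbelianGroup)

  cosetGroup : AbelianGroup ℓ ℓ
  cosetGroup = record { isAbelianGroup = *-isAbelianGroup }

  module _ {c} (c-base : InBase c) (c≉0 : ¬ c ≈ 0#) (c≉1 : ¬ c ≈ 1#) where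

    collinear⇒sum : ∀ x y z → Collinear structure x y z → CosetSum E baseUnits x y z
    collinear⇒sum x y z (inj₁ (x∼0 , y∼z)) =
      0# , y , ∼-sym x∼0 , ∼-refl , ∼-trans (∼-sym y∼z) (≈⇒∼ (sym (+-identityˡ y)))
    collinear⇒sum x y z (inj₂ (inj₁ (y∼0 , x∼z))) =
      x , 0# , ∼-refl , ∼-sym y∼0 , ∼-trans (∼-sym x∼z) (≈⇒∼ (sym (+-identityʳ x)))
    collinear⇒sum x y z (inj₂ (inj₂ (inj₁ (z∼0 , x∼y)))) = x , x , ∼-refl , x∼y , ∼-trans z∼0 (≈⇒∼ (sym (x+x≈0 x)))
    -- In x = c x + (c + 1) x both coefficients are units because c is neither 0 nor 1. Over F₂
    -- there is no such c, and x + x would be {0}.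
    collinear⇒sum x y z (inj₂ (inj₂ (inj₂ (inj₁ (x∼y , y∼z))))) =
      c * x , (c + 1#) * x , scale (c-base , c≉0) ,
      ∼-trans (scale (InBase-+ c-base InBase-1 , c≉1 ∘ x+y≈0⇒x≈y)) x∼y ,
      ∼-trans (∼-sym (∼-trans x∼y y∼z)) (≈⇒∼ (solve 2 (λ c x → x := c :* x :+ (c :+ con true) :* x) refl c x))
    collinear⇒sum x y z (inj₂ (inj₂ (inj₂ (inj₂ (x≁0 , y≁0 , z≁0 , x≁y , y≁z , x≁z))))) =
      independent⇒sum (lower ∘ x≁0 ∘ ≈⇒∼) (lower ∘ y≁0 ∘ ≈⇒∼) (lower ∘ z≁0 ∘ ≈⇒∼)
        (lower ∘ x≁y) (lower ∘ y≁z) (lower ∘ x≁z)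

    line : Line structure
    line = record
      { group = cosetGroup
      ; _≟_ = λ (x , _) (y , _) → x ∼? y
      ; emb = proj₁
      ; emb-cong = id
      ; emb-injective = id
      ; emb≉0 = λ { {_ , x≁0} → x≁0 }
      ; view = view
      ; emb-* = λ _ _ → ∼-refl
      ; emb-1 = ∼-refl
      ; emb-⁻¹ = λ _ → ∼-refl
      ; 0⁻¹≈0 = IsHyperfield.0⁻¹≈0 isHyperfield
      ; *-zeroˡ = IsHyperfield.*-zeroˡ isHyperfield
      ; *-zeroʳ = IsHyperfield.*-zeroʳ isHyperfield
      ; -x≈x = λ x → ≈⇒∼ (sym (x+y≈0⇒x≈y (-‿inverseʳ x)))
      ; +-collinear = λ x y z → mk⇔ (sum⇒collinear x y z) (collinear⇒sum x y z) }
      where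
      view : ∀ x → x ∼ 0# ⊎ ∃ λ (Y : Hyperstructure.NonZero (LStructure.reduct structure)) → x ∼ proj₁ Y
      view x with x ∼? 0#
      ... | yes x∼0 = inj₁ x∼0
      ... | no x≁0  = inj₂ ((x , x≁0) , ∼-refl)

  private module A = Combinations cosetGroup

  ·-sq^ : ∀ n (x : A.Carrier) → proj₁ ((2 ^ n) A.· x) ∼ sq^ n (proj₁ x)
  ·-sq^ zero    x = ≈⇒∼ (*-identityʳ (proj₁ x))
  ·-sq^ (suc n) x = ∼-trans (A.×-homo-+ x (2 ^ n) (2 ^ n ℕ.+ 0))
    (∼-* (·-sq^ n x) (∼-trans (A.×-congˡ {x} (ℕ.+-identityʳ (2 ^ n))) (·-sq^ n x)))

  sq^≉0 : ∀ n {x} → ¬ x ≈ 0# → ¬ sq^ n x ≈ 0#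
  sq^≉0 zero    x≉0 = x≉0
  sq^≉0 (suc n) x≉0 = *-nonzero (sq^≉0 n x≉0) (sq^≉0 n x≉0)

  -- The power x ^ (1 + 2 ^ n) is x times `sq^ n x`, which is a base unit and so trivial in the
  -- coset group.
  exponent : ∀ n → (∀ x → InBase (x * sq^ n x)) → ∀ x → suc (2 ^ n) A.· x A.≈ A.ε
  exponent n norm-base X@(x , x≁0) = ∼-trans (∼-* ∼-refl (·-sq^ n X))
    (x * sq^ n x , (norm-base x , *-nonzero x≉0 (sq^≉0 n x≉0)) , sym (*-identityʳ _))
    where x≉0 = x≁0 ∘ ≈⇒∼

  outside⇒nontrivial : ∀ {x} → ¬ InBase x → ∃ λ g → ¬ g A.≈ A.ε
  outside⇒nontrivial {x} x∉ = (x , x∉ ∘ InBase-0 ∘ ∼0⇒≈0) ,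
    λ (g , (g-base , _) , x≈g1) → x∉ (InBase-resp (trans (sym (*-identityʳ g)) (sym x≈g1)) g-base)
    where
    InBase-0 : x ≈ 0# → InBase x
    InBase-0 x≈0 = InBase-resp (trans 2≈0 (sym x≈0)) (InBase-+ InBase-1 InBase-1)

module Model {ℓ j} (S : Stage ℓ j) where
  open Stage S
  open Extension S
  private
    module F  = Field field₀
    module Fᵖ = FieldProperties field₀
    module E  = Field extension
  open Char2Solver F.commutativeRing 2≈0 using (solve; _:=_; _:+_; _:*_; con)

  subfield : QuadraticSubfield extension
  subfield = record
    { InBase = InBase
    ; InBase? = λ (p , r) → r ≟0
    ; InBase-resp = λ (_ , r≈) r≈0 → F.trans (F.sym r≈) r≈0
    ; InBase-1 = F.refl
    ; InBase-+ = λ r≈0 r′≈0 → F.trans (F.+-cong r≈0 r′≈0) (F.+-identityʳ _)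
    ; InBase-* = λ {x} {y} → InBase-* x y
    ; InBase-⁻¹ = λ {x} {y} → InBase-⁻¹ x y
    ; combination = combination }
    where
    InBase : E.Carrier → Set ℓ
    InBase (p , r) = r F.≈ F.0#

    InBase-* : ∀ x y → InBase x → InBase y → InBase (x E.* y)
    InBase-* (p , r) (p′ , r′) r≈0 r′≈0 = F.trans
      (F.+-cong (F.+-cong (F.*-congˡ r′≈0) (F.*-congʳ r≈0)) (F.*-congʳ r≈0))
      (solve 3 (λ p p′ r′ → p :* con false :+ con false :* p′ :+ con false :* r′ := con false) F.refl p p′ r′)

    InBase-⁻¹ : ∀ x y → InBase x → x E.* y E.≈ E.1# → InBase y
    InBase-⁻¹ (p , r) (p′ , r′) r≈0 (xy₁ , xy₂) = Fᵖ.xy≈0⇒y≈0 p≉0 (begin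
      p F.* r′                                   ≈⟨ solve 3 (λ p p′ r′ →
        p :* r′ := p :* r′ :+ con false :* p′ :+ con false :* r′) F.refl p p′ r′ ⟩
      p F.* r′ F.+ F.0# F.* p′ F.+ F.0# F.* r′   ≈⟨ F.+-cong (F.+-congˡ (F.*-congʳ r≈0)) (F.*-congʳ r≈0) ⟨
      p F.* r′ F.+ r F.* p′ F.+ r F.* r′         ≈⟨ xy₂ ⟩
      F.0#                                       ∎)
      where
      open SetoidReasoning F.setoid
      p≉0 : ¬ p F.≈ F.0#
      p≉0 p≈0 = F.1≉0 (F.trans (F.sym xy₁) (F.trans (F.+-cong (F.*-congʳ p≈0) (F.*-congˡ (F.*-congʳ r≈0)))
        (solve 3 (λ a p′ r′ → con false :* p′ :+ a :* (con false :* r′) := con false) F.refl a p′ r′)))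

    combination : ∀ u w → ¬ InBase w → ∃₂ λ p r → InBase p × InBase r × u E.≈ p E.+ r E.* w
    combination (u₀ , u₁) (w₀ , w₁) w₁≉0 with s , w₁s≈1 ← F.inverse w₁ w₁≉0 =
      (u₀ F.+ r F.* w₀ , F.0#) , (r , F.0#) , F.refl , F.refl ,
      solve 5 (λ a u₀ r w₀ w₁ → u₀ := (u₀ :+ r :* w₀) :+ (r :* w₀ :+ a :* (con false :* w₁))) F.refl a u₀ r w₀ w₁ ,
      F.trans (F.sym (F.trans (F.*-congˡ w₁s≈1) (F.*-identityʳ u₁)))
        (solve 4 (λ u₁ s w₀ w₁ → u₁ :* (w₁ :* s) :=
          con false :+ (u₁ :* s :* w₁ :+ con false :* w₀ :+ con false :* w₁)) F.refl u₁ s w₀ w₁)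
      where r = u₁ F.* s

  open QuadraticSubfield subfield using (InBase; InBase-resp)
  open Char2Solver E.commutativeRing 2≈0ᴱ using (sq^)

  -- x ^ 2 ^ 2 ^ j is the conjugate of x.
  norm-InBase : ∀ x → InBase (x E.* sq^ (2 ^ j) x)
  norm-InBase x@(p , r) = InBase-resp (E.*-congˡ {x} (E.sym {sq^ (2 ^ j) x} (frobenius-conj p r)))
    (solve 2 (λ p r → p :* r :+ r :* (p :+ r) :+ r :* r := con false) F.refl p r)

  open QuadraticQuotient extension _≟0ᴱ 2≈0ᴱ subfield public

  cosetGroup-good : Combinations.Good cosetGroup j
  cosetGroup-good = exponent⇒good cosetGroup (exponent (2 ^ j) norm-InBase) (λ m m<j → fermat-coprime m<j)
    (outside⇒nontrivial {F.0# , F.1#} F.1≉0)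

  krasnerLine : (∃ λ c → ¬ c F.≈ F.0# × ¬ c F.≈ F.1#) →
                Σ (LStructure ℓ) λ M → IsKrasner M × Σ (Line M) λ L → Combinations.Good (Line.group L) j
  krasnerLine (c , c≉0 , c≉1) = structure , isKrasner ,
    line {c , F.0#} F.refl (c≉0 ∘ proj₁) (c≉1 ∘ proj₁) , cosetGroup-good

-- The base field needs an element other than 0 and 1. It is therefore itself taken to be an
-- extension, namely stage `suc N`, whose α is that element.
krasnerModel : ∀ {ℓ} N → Σ (LStructure ℓ) λ M →
               IsKrasner M × Σ (Line M) λ L → Combinations.Good (Line.group L) (suc N)
krasnerModel N = Model.krasnerLine (Extension.next (stage N)) (Extension.generator (stage N))

-- The structure L(A) of an abelian group.

collinearIn-resp : ∀ {ℓ} {C : Set ℓ} {_≈_ : Rel C ℓ} {o : C} → IsEquivalence _≈_ → ∀ {x x′ y y′ z z′} →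
                   x ≈ x′ → y ≈ y′ → z ≈ z′ → CollinearIn _≈_ o x y z → CollinearIn _≈_ o x′ y′ z′
collinearIn-resp {_≈_ = _≈_} {o} eq p q r =
  [ (λ (a , b) → inj₁ (left p a , both q r b)) , inj₂ ∘
  [ (λ (a , b) → inj₁ (left q a , both p r b)) , inj₂ ∘
  [ (λ (a , b) → inj₁ (left r a , both p q b)) , inj₂ ∘
  [ (λ (a , b) → inj₁ (both p q a , both q r b)) , inj₂ ∘
    (λ (a , b , c , d , e , f) →
      a ∘ left (sym p) , b ∘ left (sym q) , c ∘ left (sym r) ,
      d ∘ both (sym p) (sym q) , e ∘ both (sym q) (sym r) , f ∘ both (sym p) (sym r)) ]′ ]′ ]′ ]′
  where
  open IsEquivalence eq
  left : ∀ {u u′} → u ≈ u′ → u ≈ o → u′ ≈ o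
  left p a = trans (sym p) a
  both : ∀ {u u′ v v′} → u ≈ u′ → v ≈ v′ → u ≈ v → u′ ≈ v′
  both p q a = trans (sym p) (trans a q)

module LineStructure {ℓ} (A : AbelianGroup ℓ ℓ) where
  private module A = AbelianGroup A

  _≈ᴹ_ : Rel (Maybe A.Carrier) ℓ
  _≈ᴹ_ = Pointwise A._≈_

  ≈ᴹ-isEquivalence : IsEquivalence _≈ᴹ_
  ≈ᴹ-isEquivalence = Pointwise.isEquivalence A.isEquivalence

  zipWith-cong : ∀ {x x′ y y′} → x ≈ᴹ x′ → y ≈ᴹ y′ → Maybe.zipWith A._∙_ x y ≈ᴹ Maybe.zipWith A._∙_ x′ y′
  zipWith-cong (just p) (just q) = just (A.∙-cong p q)
  zipWith-cong (just p) nothing  = nothing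
  zipWith-cong nothing  _        = nothing

  structure : LStructure ℓ
  structure = record
    { reduct = record
      { Carrier = Maybe A.Carrier
      ; _≈_ = _≈ᴹ_
      ; isEquivalence = ≈ᴹ-isEquivalence
      ; _+_ = CollinearIn _≈ᴹ_ nothing
      ; _*_ = Maybe.zipWith A._∙_
      ; 0# = nothing
      ; 1# = just A.ε
      ; +-resp = collinearIn-resp ≈ᴹ-isEquivalence
      ; *-cong = zipWith-cong }
    ; -_ = id
    ; _⁻¹ = Maybe.map A._⁻¹
    ; -‿cong = id
    ; ⁻¹-cong = λ { (just p) → just (A.⁻¹-cong p) ; nothing → nothing } }

  line : Decidable A._≈_ → Line structure
  line _≟_ = record
    { group = A
    ; _≟_ = _≟_
    ; emb = just
    ; emb-cong = just
    ; emb-injective = drop-just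
    ; emb≉0 = λ ()
    ; view = λ { nothing → inj₁ nothing ; (just x) → inj₂ (x , just A.refl) }
    ; emb-* = λ _ _ → just A.refl
    ; emb-1 = just A.refl
    ; emb-⁻¹ = λ _ → just A.refl
    ; 0⁻¹≈0 = nothing
    ; *-zeroˡ = λ _ → nothing
    ; *-zeroʳ = λ { nothing → nothing ; (just _) → nothing }
    ; -x≈x = λ _ → IsEquivalence.refl ≈ᴹ-isEquivalence
    ; +-collinear = λ _ _ _ → mk⇔ id id }

-- L(A) is not Krasner when A has rank one.

-- Coefficients are positive, so the two alternatives account for the relative sign of x and y.
RankOne : ∀ {ℓ} → AbelianGroup ℓ ℓ → Set ℓ
RankOne A = ∀ {x y} → ¬ x ≈ ε → ¬ y ≈ ε →
  ∃₂ λ m n → suc m · x ≈ suc n · y ⊎ suc m · x ∙ suc n · y ≈ ε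
  where open Combinations A

bitFin : Bool → Fin 2
bitFin true  = suc zero
bitFin false = zero

bitFin-injective : ∀ b c → bitFin b ≡ bitFin c → b ≡ c
bitFin-injective true  true  _ = ≡.refl
bitFin-injective false false _ = ≡.refl

encode : ∀ {d} → Vec Bool d → Fin (2 ^ d)
encode []      = zero
encode (b ∷ v) = Fin.combine (bitFin b) (encode v)

encode-injective : ∀ {d} (v w : Vec Bool d) → encode v ≡ encode w → v ≡ w
encode-injective []      []      _  = ≡.refl
encode-injective (b ∷ v) (c ∷ w) eq
  with b≡c , v≡w ← Fin.combine-injective (bitFin b) (encode v) (bitFin c) (encode w) eq =
  ≡.cong₂ _∷_ (bitFin-injective b c b≡c) (encode-injective v w v≡w)

-- K is graded by A: every nonzero x has a degree, and k, the elements of degree ε and 0, is a subfield.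
module Grading {ℓ} (A : AbelianGroup ℓ ℓ) (_≟_ : Decidable (AbelianGroup._≈_ A)) (K : Field ℓ) (G : Subgroup K)
               (iso : LStructure.reduct (LineStructure.structure A) ≅ (K / G)) where
  private module A = Combinations A
  open Field K
  open FieldProperties K
  open LineStructure A using (_≈ᴹ_)
  open Subgroup G using (member)
  open Cosets K G public
  open _≅_ iso
  open RingProperties ring using (-1*x≈-x)
  open AbelianGroupProperties +-abelianGroup using (inverseʳ-unique)
  open Exp semiring using (^-congˡ) renaming (_^_ to _^ᴷ_)

  infix 4 _∶_
  _∶_ : Carrier → A.Carrier → Set ℓ
  x ∶ a = x ∼ to (just a)

  ∶-resp : ∀ {x y a b} → x ≈ y → a A.≈ b → x ∶ a → y ∶ b
  ∶-resp x≈y a≈b x∶a = ∼-trans (≈⇒∼ (sym x≈y)) (∼-trans x∶a (to-cong (just a≈b)))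

  ∶-unique : ∀ {x a b} → x ∶ a → x ∶ b → a A.≈ b
  ∶-unique x∶a x∶b = drop-just (proj₁ bijective (∼-trans (∼-sym x∶a) x∶b))

  ∶-* : ∀ {x y a b} → x ∶ a → y ∶ b → x * y ∶ a A.∙ b
  ∶-* x∶a y∶b = ∼-trans (∼-* x∶a y∶b) (∼-sym (*-homo _ _))

  ∶-1 : 1# ∶ A.ε
  ∶-1 = ∼-sym 1-homo

  ∶-^ : ∀ {x a} n → x ∶ a → x ^ᴷ n ∶ n A.· a
  ∶-^ zero    x∶a = ∶-1
  ∶-^ (suc n) x∶a = ∶-* x∶a (∶-^ n x∶a)

  ∶⇒≉0 : ∀ {x a} → x ∶ a → ¬ x ≈ 0#
  ∶⇒≉0 x∶a x≈0 with () ← proj₁ bijective (∼-trans (∼-sym x∶a) (∼-trans (≈⇒∼ x≈0) (∼-sym 0-homo)))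

  -- Surjectivity of the isomorphism yields a preimage in `Maybe`, whose constructor tells zero from
  -- nonzero. This is how K acquires a decidable zero test.
  grade? : ∀ x → x ≈ 0# ⊎ ∃ λ a → x ∶ a
  grade? x with proj₂ bijective x
  ... | nothing , to≈ = inj₁ (∼0⇒≈0 (∼-trans (∼-sym (to≈ nothing)) 0-homo))
  ... | just a  , to≈ = inj₂ (a , ∼-sym (to≈ (just A.refl)))

  grade : ∀ {x} → ¬ x ≈ 0# → ∃ λ a → x ∶ a
  grade {x} x≉0 = [ (λ x≈0 → contradiction x≈0 x≉0) , id ]′ (grade? x)

  _≟0 : ∀ x → Dec (x ≈ 0#)
  x ≟0 = [ yes , (λ (a , x∶a) → no (∶⇒≉0 x∶a)) ]′ (grade? x)

  ∶-quotient : ∀ {x y a b} → x ∶ a → x * y ∶ b → y ∶ a A.⁻¹ A.∙ b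
  ∶-quotient {x} {y} {a} {b} x∶a xy∶b with c , y∶c ← grade (factorʳ≉0 (∶⇒≉0 xy∶b)) =
    ∶-resp refl (A.sym (A.trans (A.∙-congˡ (∶-unique xy∶b (∶-* x∶a y∶c)))
      (A.trans (A.sym (A.assoc _ _ _)) (A.trans (A.∙-congʳ (A.inverseˡ a)) (A.identityˡ c))))) y∶c

  member⇒∶ε : ∀ {x} → member x → x ∶ A.ε
  member⇒∶ε {x} x∈ = ∼-trans (x , x∈ , sym (*-identityʳ x)) ∶-1

  k : Carrier → Set ℓ
  k x = x ≈ 0# ⊎ x ∶ A.ε

  k-resp : ∀ {x y} → x ≈ y → k x → k y
  k-resp x≈y (inj₁ x≈0) = inj₁ (trans (sym x≈y) x≈0)
  k-resp x≈y (inj₂ x∶ε) = inj₂ (∶-resp x≈y A.refl x∶ε)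

  k-∶ : ∀ {x a} → k x → x ∶ a → a A.≈ A.ε
  k-∶ (inj₁ x≈0) x∶a = contradiction x≈0 (∶⇒≉0 x∶a)
  k-∶ (inj₂ x∶ε) x∶a = ∶-unique x∶a x∶ε

  k-nonzero : ∀ {x} → k x → ¬ x ≈ 0# → x ∶ A.ε
  k-nonzero (inj₁ x≈0) x≉0 = contradiction x≈0 x≉0
  k-nonzero (inj₂ x∶ε) _   = x∶ε

  k-1 : k 1#
  k-1 = inj₂ ∶-1

  k-0 : k 0#
  k-0 = inj₁ refl

  k-* : ∀ {x y} → k x → k y → k (x * y)
  k-* (inj₁ x≈0) _          = inj₁ (trans (*-congʳ x≈0) (zeroˡ _))
  k-* (inj₂ _)   (inj₁ y≈0) = inj₁ (trans (*-congˡ y≈0) (zeroʳ _))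
  k-* (inj₂ x∶ε) (inj₂ y∶ε) = inj₂ (∶-resp refl (A.identityˡ _) (∶-* x∶ε y∶ε))

  -- In L(A) the hypersum of ε with itself is {0 , ε}.
  k-+ : ∀ {x y} → k x → k y → k (x + y)
  k-+ (inj₁ x≈0) ky         = k-resp (sym (trans (+-congʳ x≈0) (+-identityˡ _))) ky
  k-+ kx         (inj₁ y≈0) = k-resp (sym (trans (+-congˡ y≈0) (+-identityʳ _))) kx
  k-+ {x} {y} (inj₂ x∶ε) (inj₂ y∶ε) with w , to≈ ← proj₂ bijective (x + y) =
    on-line w (to≈ (IsEquivalence.refl (LineStructure.≈ᴹ-isEquivalence A)))
      (Equivalence.from (+-homo (just A.ε) (just A.ε) w)
        (x , y , x∶ε , y∶ε , to≈ (IsEquivalence.refl (LineStructure.≈ᴹ-isEquivalence A))))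
    where
    on-line : ∀ w → to w ∼ x + y → CollinearIn _≈ᴹ_ nothing (just A.ε) (just A.ε) w → k (x + y)
    on-line nothing  w∼ _ = inj₁ (∼0⇒≈0 (∼-trans (∼-sym w∼) 0-homo))
    on-line (just c) w∼ (inj₁ (() , _))
    on-line (just c) w∼ (inj₂ (inj₁ (() , _)))
    on-line (just c) w∼ (inj₂ (inj₂ (inj₁ (() , _))))
    on-line (just c) w∼ (inj₂ (inj₂ (inj₂ (inj₁ (_ , ε≈c))))) = inj₂ (∼-trans (∼-sym w∼) (∼-sym (to-cong ε≈c)))
    on-line (just c) w∼ (inj₂ (inj₂ (inj₂ (inj₂ (_ , _ , _ , ε≉ε , _))))) = ⊥-elim (lower (ε≉ε (just A.refl)))

  -- As 0 lies in the hypersum of ε with itself, some x₁ and -x₁ both have degree ε, and so has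
  -- their quotient -1.
  k-neg : ∀ {x} → k x → k (- x)
  k-neg {x} kx = k-resp (-1*x≈-x x) (k-* k-1⁻ kx)
    where
    k-1⁻ : k (- 1#)
    k-1⁻ with x₁ , y₁ , x₁∶ε , y₁∶ε , 0∼ ←
      Equivalence.to (+-homo (just A.ε) (just A.ε) nothing) (inj₂ (inj₂ (inj₁ (nothing , just A.refl)))) =
      inj₂ (∶-resp refl (A.inverseˡ A.ε) (∶-quotient x₁∶ε (∶-resp y₁≈ A.refl y₁∶ε)))
      where
      y₁≈ : y₁ ≈ x₁ * - 1#
      y₁≈ = trans (inverseʳ-unique x₁ y₁ (∼0⇒≈0 (∼-trans (∼-sym 0∼) 0-homo)))
        (sym (trans (*-comm x₁ (- 1#)) (-1*x≈-x x₁)))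

  quadratic : ∀ {α g} → α ∶ g → ¬ g A.≈ A.ε → (∀ {x} → x A.∙ x A.≈ A.ε → x A.≈ A.ε) →
              ∃₂ λ s t → s ∶ A.ε × t ∶ A.ε × α * α ≈ s * α + t
  quadratic {α} {g} α∶g g≉ε torsionFree
    with x₁ , y₁ , x₁∶ε , y₁∶g , gg∼ ← Equivalence.to (+-homo (just A.ε) (just g) (just (g A.∙ g)))
      (inj₂ (inj₂ (inj₂ (inj₂ ((λ ()) , (λ ()) , (λ ()) ,
        lift ∘ g≉ε ∘ A.sym ∘ drop-just ,
        lift ∘ g≉ε ∘ A.sym ∘ A.∙-cancelˡ g _ _ ∘ A.trans (A.identityʳ g) ∘ drop-just ,
        lift ∘ g≉ε ∘ torsionFree ∘ A.sym ∘ drop-just)))))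
    with h , h∈ , αα≈ ← ∼-trans (∶-* α∶g α∶g) gg∼
    with h′ , h′∈ , y₁≈ ← ∼-trans y₁∶g (∼-sym α∶g) =
    h * h′ , h * x₁ , ∶-resp refl (A.identityˡ _) (∶-* (member⇒∶ε h∈) (member⇒∶ε h′∈)) ,
    ∶-resp refl (A.identityˡ _) (∶-* (member⇒∶ε h∈) x₁∶ε) ,
    trans αα≈ (trans (distribˡ h x₁ y₁) (trans (+-comm _ _) (+-congʳ (trans (*-congˡ y₁≈) (sym (*-assoc h h′ α))))))

  -- Otherwise 2α - s is a square root of an element of k but has degree different from ε.
  characteristic-2 : ∀ {α g s t} → α ∶ g → ¬ g A.≈ A.ε → (∀ {x} → x A.∙ x A.≈ A.ε → x A.≈ A.ε) →
                     k s → k t → α * α ≈ s * α + t → 1# + 1# ≈ 0#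
  characteristic-2 {α} {g} {s} {t} α∶g g≉ε torsionFree ks kt αα≈ = decidable-stable ((1# + 1#) ≟0) λ 2≉0 →
    g≉ε (A.trans (A.sym (A.identityˡ g)) (k-∶ k2α (∶-* (k-nonzero (k-+ k-1 k-1) 2≉0) α∶g)))
    where
    open SemiringSolver commutativeSemiring using (solve; _:=_; _:+_; _:*_)
    n = - s
    β = α + α + n

    ββ≈ : β * β ≈ t + t + (t + t) + n * n
    ββ≈ = begin
      β * β
        ≈⟨ solve 2 (λ α n → (α :+ α :+ n) :* (α :+ α :+ n) :=
             (α :* α :+ α :* α) :+ (α :* α :+ α :* α) :+ (α :* n :+ α :* n :+ (α :* n :+ α :* n)) :+ n :* n) refl α n ⟩
      (α * α + α * α) + (α * α + α * α) + (α * n + α * n + (α * n + α * n)) + n * n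
        ≈⟨ +-congʳ (+-congʳ (+-cong (+-cong αα≈ αα≈) (+-cong αα≈ αα≈))) ⟩
      ((s * α + t) + (s * α + t)) + ((s * α + t) + (s * α + t)) + (α * n + α * n + (α * n + α * n)) + n * n
        ≈⟨ solve 4 (λ s t α n →
             ((s :* α :+ t) :+ (s :* α :+ t)) :+ ((s :* α :+ t) :+ (s :* α :+ t)) :+
               (α :* n :+ α :* n :+ (α :* n :+ α :* n)) :+ n :* n :=
             (t :+ t :+ (t :+ t) :+ n :* n) :+ (α :+ α :+ (α :+ α)) :* (s :+ n)) refl s t α n ⟩
      t + t + (t + t) + n * n + (α + α + (α + α)) * (s + n)
        ≈⟨ +-congˡ (trans (*-congˡ (-‿inverseʳ s)) (zeroʳ _)) ⟩
      t + t + (t + t) + n * n + 0#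
        ≈⟨ +-identityʳ _ ⟩
      t + t + (t + t) + n * n ∎
      where open SetoidReasoning setoid

    kββ : k (β * β)
    kββ = k-resp (sym ββ≈) (k-+ (k-+ (k-+ kt kt) (k-+ kt kt)) (k-* (k-neg ks) (k-neg ks)))

    kβ : k β
    kβ with grade? β
    ... | inj₁ β≈0       = inj₁ β≈0
    ... | inj₂ (b , β∶b) = inj₂ (∶-resp refl (torsionFree (k-∶ kββ (∶-* β∶b β∶b))) β∶b)

    k2α : k ((1# + 1#) * α)
    k2α = k-resp (begin
      α + α + n + s         ≈⟨ +-assoc _ _ _ ⟩
      α + α + (n + s)       ≈⟨ +-congˡ (-‿inverseˡ s) ⟩
      α + α + 0#            ≈⟨ +-identityʳ _ ⟩
      α + α                 ≈⟨ +-cong (*-identityˡ α) (*-identityˡ α) ⟨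
      1# * α + 1# * α       ≈⟨ distribʳ α 1# 1# ⟨
      (1# + 1#) * α         ∎) (k-+ kβ ks)
      where open SetoidReasoning setoid

  module ArtinSchreier (good : ∀ N → A.Good N) (rankOne : RankOne A)
                       (2≈0 : 1# + 1# ≈ 0#) {α g a} (α∶g : α ∶ g) (g≉ε : ¬ g A.≈ A.ε)
                       (a∶ε : a ∶ A.ε) (αα≈ : α * α ≈ α + a) where
    open Char2Solver commutativeRing 2≈0 using (solve; _:=_; _:+_; _:*_; con; x+x≈0; x+y≈0⇒x≈y; bit; bit-+; bit-*)
    private
      ring₂ = Quadratic.ring₂ commutativeRing 2≈0 a
      module E = CommutativeRing ring₂
    open Exp E.semiring using () renaming (_^_ to _^ᴱ_)

    infinite-order : ∀ {x i j} → ¬ x A.≈ A.ε → i < j → ¬ i A.· x A.≈ j A.· x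
    infinite-order {j = j} x≉ε i<j = A.multiples-distinct (good j) x≉ε i<j ℕ.≤-refl

    ka : k a
    ka = inj₂ a∶ε

    -- Evaluation at a root θ of T² + T + a. Both α and `ᾱ` are roots, and conjugation is the
    -- passage from one evaluation to the other.
    eval : Carrier → E.Carrier → Carrier
    eval θ (p , r) = p + r * θ

    eval-cong : ∀ θ {x y} → x E.≈ y → eval θ x ≈ eval θ y
    eval-cong θ (p , r) = +-cong p (*-congʳ r)

    eval-* : ∀ {θ} → θ * θ ≈ θ + a → ∀ x y → eval θ (x E.* y) ≈ eval θ x * eval θ y
    eval-* {θ} θθ≈ (p , r) (p′ , r′) = begin
      p * p′ + a * (r * r′) + (p * r′ + r * p′ + r * r′) * θ
        ≈⟨ solve 6 (λ p r p′ r′ a θ → p :* p′ :+ a :* (r :* r′) :+ (p :* r′ :+ r :* p′ :+ r :* r′) :* θ :=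
             p :* p′ :+ (p :* r′ :+ r :* p′) :* θ :+ r :* r′ :* (θ :+ a)) refl p r p′ r′ a θ ⟩
      p * p′ + (p * r′ + r * p′) * θ + r * r′ * (θ + a)
        ≈⟨ +-congˡ (*-congˡ θθ≈) ⟨
      p * p′ + (p * r′ + r * p′) * θ + r * r′ * (θ * θ)
        ≈⟨ solve 5 (λ p r p′ r′ θ → p :* p′ :+ (p :* r′ :+ r :* p′) :* θ :+ r :* r′ :* (θ :* θ) :=
             (p :+ r :* θ) :* (p′ :+ r′ :* θ)) refl p r p′ r′ θ ⟩
      (p + r * θ) * (p′ + r′ * θ) ∎
      where open SetoidReasoning setoid

    eval-^ : ∀ {θ} → θ * θ ≈ θ + a → ∀ x n → eval θ (x ^ᴱ n) ≈ eval θ x ^ᴷ n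
    eval-^ {θ} θθ≈ x zero    = solve 1 (λ θ → con true :+ con false :* θ := con true) refl θ
    eval-^ {θ} θθ≈ x (suc n) = trans (eval-* θθ≈ x (x ^ᴱ n)) (*-congˡ (eval-^ θθ≈ x n))

    k₂ : E.Carrier → Set ℓ
    k₂ (p , r) = k p × k r

    k₂-* : ∀ {x y} → k₂ x → k₂ y → k₂ (x E.* y)
    k₂-* (kp , kr) (kp′ , kr′) = k-+ (k-* kp kp′) (k-* ka (k-* kr kr′)) , k-+ (k-+ (k-* kp kr′) (k-* kr kp′)) (k-* kr kr′)

    k₂-^ : ∀ {x} n → k₂ x → k₂ (x ^ᴱ n)
    k₂-^ zero    kx = k-1 , k-0
    k₂-^ {x} (suc n) kx = k₂-* {x} {x ^ᴱ n} kx (k₂-^ n kx)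

    -- Were r ≠ r′, the element (r + r′) α = p + p′ would have degree g and lie in k.
    eval-α-injective : ∀ {x y} → k₂ x → k₂ y → eval α x ≈ eval α y → x E.≈ y
    eval-α-injective {p , r} {p′ , r′} (kp , kr) (kp′ , kr′) eq = p≈p′ , r≈r′
      where
      open SetoidReasoning setoid
      difference : (r + r′) * α ≈ p + p′
      difference = begin
        (r + r′) * α                       ≈⟨ solve 4 (λ p r r′ α →
          (r :+ r′) :* α := (p :+ r :* α) :+ (p :+ r′ :* α)) refl p r r′ α ⟩
        (p + r * α) + (p + r′ * α)         ≈⟨ +-congʳ eq ⟩
        (p′ + r′ * α) + (p + r′ * α)       ≈⟨ solve 4 (λ p p′ r′ α →
          (p′ :+ r′ :* α) :+ (p :+ r′ :* α) := p :+ p′) refl p p′ r′ α ⟩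
        p + p′                             ∎
      r≈r′ : r ≈ r′
      r≈r′ = x+y≈0⇒x≈y (decidable-stable ((r + r′) ≟0) λ r+r′≉0 →
        g≉ε (A.trans (A.sym (A.identityˡ g)) (k-∶ (k-resp (sym difference) (k-+ kp kp′))
          (∶-* (k-nonzero (k-+ kr kr′) r+r′≉0) α∶g))))
      p≈p′ : p ≈ p′
      p≈p′ = x+y≈0⇒x≈y (trans (sym difference) (trans (*-congʳ (trans (+-congʳ r≈r′) (x+x≈0 r′))) (zeroˡ α)))

    ᾱ : Carrier
    ᾱ = α + 1#

    ᾱᾱ≈ : ᾱ * ᾱ ≈ ᾱ + a
    ᾱᾱ≈ = trans (solve 1 (λ α → (α :+ con true) :* (α :+ con true) := α :* α :+ con true) refl α)
      (trans (+-congʳ αα≈) (solve 2 (λ α a → α :+ a :+ con true := α :+ con true :+ a) refl α a))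

    conjugate-equation : ∀ {x y} → k₂ x → k₂ y → eval α x ≈ eval α y → eval ᾱ x ≈ eval ᾱ y
    conjugate-equation kx ky eq = eval-cong ᾱ (eval-α-injective kx ky eq)

    -- Coefficients are taken in F₂ rather than k, so that there are finitely many polynomials of a
    -- given length.
    evalPoly : List Bool → Carrier
    evalPoly []      = 0#
    evalPoly (b ∷ l) = bit b + α * evalPoly l

    addPoly : List Bool → List Bool → List Bool
    addPoly []      m       = m
    addPoly (b ∷ l) []      = b ∷ l
    addPoly (b ∷ l) (c ∷ m) = (b xor c) ∷ addPoly l m

    evalPoly-add : ∀ l m → evalPoly (addPoly l m) ≈ evalPoly l + evalPoly m
    evalPoly-add []      m       = sym (+-identityˡ _)
    evalPoly-add (b ∷ l) []      = sym (+-identityʳ _)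
    evalPoly-add (b ∷ l) (c ∷ m) = trans (+-cong (bit-+ b c) (*-congˡ (evalPoly-add l m)))
      (solve 5 (λ α b c l m → b :+ c :+ α :* (l :+ m) := (b :+ α :* l) :+ (c :+ α :* m)) refl α _ _ _ _)

    IsPoly : Carrier → Set ℓ
    IsPoly x = ∃ λ l → x ≈ evalPoly l

    isPoly-resp : ∀ {x y} → x ≈ y → IsPoly x → IsPoly y
    isPoly-resp x≈y (l , x≈l) = l , trans (sym x≈y) x≈l

    isPoly-1 : IsPoly 1#
    isPoly-1 = true ∷ [] , sym (trans (+-congˡ (zeroʳ α)) (+-identityʳ 1#))

    isPoly-+ : ∀ {x y} → IsPoly x → IsPoly y → IsPoly (x + y)
    isPoly-+ (l , x≈l) (m , y≈m) = addPoly l m , trans (+-cong x≈l y≈m) (sym (evalPoly-add l m))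

    isPoly-α* : ∀ {x} → IsPoly x → IsPoly (α * x)
    isPoly-α* (l , x≈l) = false ∷ l , trans (*-congˡ x≈l) (sym (+-identityˡ _))

    isPoly-bit* : ∀ b {x} → IsPoly x → IsPoly (bit b * x)
    isPoly-bit* true  px = isPoly-resp (sym (*-identityˡ _)) px
    isPoly-bit* false px = [] , zeroˡ _

    isPoly-* : ∀ {x y} → IsPoly x → IsPoly y → IsPoly (x * y)
    isPoly-* {y = y} (l , x≈l) py = isPoly-resp (*-congʳ (sym x≈l)) (evalPoly-* l)
      where
      evalPoly-* : ∀ l → IsPoly (evalPoly l * y)
      evalPoly-* []      = [] , zeroˡ y
      evalPoly-* (b ∷ l) = isPoly-resp
        (solve 4 (λ α b l y → b :* y :+ α :* (l :* y) := (b :+ α :* l) :* y) refl α (bit b) (evalPoly l) y)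
        (isPoly-+ (isPoly-bit* b py) (isPoly-α* (evalPoly-* l)))

    evalVec : ∀ {d} → Vec Bool d → Carrier
    evalVec v = evalPoly (Vec.toList v)

    -- If α l = 1, dividing the polynomial b + α p by α gives p + b l, again with at most d coefficients.
    divideα : ∀ {d} → Vec Bool d → Vec Bool d → Vec Bool d
    divideα l []      = []
    divideα l (b ∷ p) = Vec.zipWith _xor_ (p Vec.∷ʳ false) (Vec.map (b ∧_) l)

    evalVec-xor : ∀ {d} (v w : Vec Bool d) → evalVec (Vec.zipWith _xor_ v w) ≈ evalVec v + evalVec w
    evalVec-xor []      []      = sym (+-identityˡ 0#)
    evalVec-xor (b ∷ v) (c ∷ w) = trans (+-cong (bit-+ b c) (*-congˡ (evalVec-xor v w)))
      (solve 5 (λ α b c l m → b :+ c :+ α :* (l :+ m) := (b :+ α :* l) :+ (c :+ α :* m)) refl α _ _ _ _)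

    evalVec-∷ʳ : ∀ {d} (v : Vec Bool d) → evalVec (v Vec.∷ʳ false) ≈ evalVec v
    evalVec-∷ʳ []      = trans (+-identityˡ _) (zeroʳ α)
    evalVec-∷ʳ (b ∷ v) = +-congˡ (*-congˡ (evalVec-∷ʳ v))

    evalVec-∧ : ∀ {d} b (v : Vec Bool d) → evalVec (Vec.map (b ∧_) v) ≈ bit b * evalVec v
    evalVec-∧ b []      = sym (zeroʳ _)
    evalVec-∧ b (c ∷ v) = trans (+-cong (bit-* b c) (*-congˡ (evalVec-∧ b v)))
      (solve 4 (λ α b c v → b :* c :+ α :* (b :* v) := b :* (c :+ α :* v)) refl α (bit b) (bit c) (evalVec v))

    evalVec-divideα : ∀ {d} (l p : Vec Bool d) → 1# ≈ α * evalVec l → α * evalVec (divideα l p) ≈ evalVec p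
    evalVec-divideα l []      _     = zeroʳ α
    evalVec-divideα l (b ∷ p) 1≈αl = begin
      α * evalVec (divideα l (b ∷ p))
        ≈⟨ *-congˡ (trans (evalVec-xor (p Vec.∷ʳ false) _) (+-cong (evalVec-∷ʳ p) (evalVec-∧ b l))) ⟩
      α * (evalVec p + bit b * evalVec l)
        ≈⟨ solve 4 (λ α b p l → α :* (p :+ b :* l) := b :* (α :* l) :+ α :* p) refl α (bit b) (evalVec p) (evalVec l) ⟩
      bit b * (α * evalVec l) + α * evalVec p
        ≈⟨ +-congʳ (trans (*-congˡ (sym 1≈αl)) (*-identityʳ _)) ⟩
      bit b + α * evalVec p ∎
      where open SetoidReasoning setoid

    -- By pigeonhole on coefficient vectors the powers of α would repeat.
    α⁻¹-not-poly : ∀ {x} → IsPoly x → ¬ 1# ≈ α * x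
    α⁻¹-not-poly {x} (coeffs , x≈) 1≈αx = repetition (Fin.pigeonhole (ℕ.n<1+n _) (λ i → encode (orbit (toℕ i))))
      where
      d = List.length coeffs
      l = Vec.fromList coeffs

      1≈αl : 1# ≈ α * evalVec l
      1≈αl = trans 1≈αx (*-congˡ (trans x≈ (reflexive (≡.cong evalPoly (≡.sym (Vec.toList∘fromList coeffs))))))

      orbit : ℕ → Vec Bool d
      orbit zero    = l
      orbit (suc i) = divideα l (orbit i)

      -- The product stays fixed while the power of α grows, so equal vectors at i < j would force i
      -- · g = j · g.
      orbit-^ : ∀ i → α ^ᴷ i * evalVec (orbit i) ≈ evalVec l
      orbit-^ zero    = *-identityˡ _
      orbit-^ (suc i) = trans (solve 3 (λ α p e → α :* p :* e := p :* (α :* e)) refl α _ _)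
        (trans (*-congˡ (evalVec-divideα l (orbit i) 1≈αl)) (orbit-^ i))

      l∶ = proj₂ (grade (factorʳ≉0 (1≉0 ∘ trans 1≈αl)))
      grade-orbit : ℕ → A.Carrier
      grade-orbit i = proj₁ (grade (factorʳ≉0 (∶⇒≉0 (∶-resp (sym (orbit-^ i)) A.refl l∶))))
      orbit-∶ : ∀ i → evalVec (orbit i) ∶ grade-orbit i
      orbit-∶ i = proj₂ (grade (factorʳ≉0 (∶⇒≉0 (∶-resp (sym (orbit-^ i)) A.refl l∶))))

      grade-l : ∀ i → proj₁ (grade (factorʳ≉0 (1≉0 ∘ trans 1≈αl))) A.≈ i A.· g A.∙ grade-orbit i
      grade-l i = ∶-unique (∶-resp (sym (orbit-^ i)) A.refl l∶) (∶-* (∶-^ i α∶g) (orbit-∶ i))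

      repetition : ¬ ∃₂ λ (i j : Fin (suc (2 ^ d))) → i Fin.< j × encode (orbit (toℕ i)) ≡ encode (orbit (toℕ j))
      repetition (i , j , i<j , eq) = infinite-order g≉ε i<j (A.∙-cancelʳ (grade-orbit (toℕ j)) _ _ (A.trans
        (A.∙-congˡ (∶-unique (orbit-∶ (toℕ j)) (≡.subst (λ v → evalVec v ∶ grade-orbit (toℕ i))
          (encode-injective (orbit (toℕ i)) (orbit (toℕ j)) eq) (orbit-∶ (toℕ i)))))
        (A.trans (A.sym (grade-l (toℕ i))) (grade-l (toℕ j)))))

    isPoly-α^ : ∀ n → IsPoly (α ^ᴷ n)
    isPoly-α^ zero    = isPoly-1
    isPoly-α^ (suc n) = isPoly-α* (isPoly-α^ n)

    -- Values of polynomials over F₂ with constant term 1, a class closed under products.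
    OnePlus : Carrier → Set ℓ
    OnePlus x = ∃ λ p → IsPoly p × x ≈ 1# + α * p

    onePlus-* : ∀ {x y} → OnePlus x → OnePlus y → OnePlus (x * y)
    onePlus-* (p , pp , x≈) (q , pq , y≈) = p + q + α * (p * q) , isPoly-+ (isPoly-+ pp pq) (isPoly-α* (isPoly-* pp pq)) ,
      trans (*-cong x≈ y≈) (solve 3 (λ α p q →
        (con true :+ α :* p) :* (con true :+ α :* q) := con true :+ α :* (p :+ q :+ α :* (p :* q))) refl α p q)

    onePlus-^ : ∀ {x} n → OnePlus x → OnePlus (x ^ᴷ n)
    onePlus-^ zero    _  = 0# , ([] , refl) , sym (trans (+-congˡ (zeroʳ α)) (+-identityʳ 1#))
    onePlus-^ (suc n) ux = onePlus-* ux (onePlus-^ n ux)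

    onePlus⇒isPoly : ∀ {x} → OnePlus x → IsPoly x
    onePlus⇒isPoly (p , pp , x≈) = isPoly-resp (sym x≈) (isPoly-+ isPoly-1 (isPoly-α* pp))

    -- From 1 + α p = α y it would follow that 1 = α (y + p), making the inverse of α a polynomial
    -- in α.
    onePlus≉α* : ∀ {x y} → OnePlus x → IsPoly y → ¬ x ≈ α * y
    onePlus≉α* {x} {y} (p , pp , x≈) py x≈αy = α⁻¹-not-poly (isPoly-+ py pp) (begin
      1#                          ≈⟨ solve 2 (λ α p → con true := con true :+ α :* p :+ α :* p) refl α p ⟩
      1# + α * p + α * p          ≈⟨ +-congʳ (trans (sym x≈) x≈αy) ⟩
      α * y + α * p               ≈⟨ distribˡ α y p ⟨
      α * (y + p)                 ∎)
      where open SetoidReasoning setoid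

    -- In terms of α alone, y = α³ + α + 1 and its conjugate ȳ = α³ + α² + 1.
    y ȳ : Carrier
    y = eval α (a + 1# , a)
    ȳ = eval ᾱ (a + 1# , a)

    a≈ : a ≈ α * α + α
    a≈ = sym (trans (+-congʳ αα≈) (solve 2 (λ α a → α :+ a :+ α := a) refl α a))

    isPoly-α : IsPoly α
    isPoly-α = isPoly-resp (*-identityʳ α) (isPoly-α* isPoly-1)

    y-onePlus : OnePlus y
    y-onePlus = 1# + α * α , isPoly-+ isPoly-1 (isPoly-α* isPoly-α) ,
      trans (+-cong (+-congʳ a≈) (*-congʳ a≈))
        (solve 1 (λ α → α :* α :+ α :+ con true :+ (α :* α :+ α) :* α := con true :+ α :* (con true :+ α :* α)) refl α)

    ȳ-onePlus : OnePlus ȳ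
    ȳ-onePlus = α + α * α , isPoly-+ isPoly-α (isPoly-α* isPoly-α) ,
      trans (+-cong (+-congʳ a≈) (*-congʳ a≈))
        (solve 1 (λ α → α :* α :+ α :+ con true :+ (α :* α :+ α) :* (α :+ con true) := con true :+ α :* (α :+ α :* α)) refl α)

    ᾱ-onePlus : OnePlus ᾱ
    ᾱ-onePlus = 1# , isPoly-1 , solve 1 (λ α → α :+ con true := con true :+ α :* con true) refl α

    -- Otherwise y + (a + 1) = a α would lie in k, although its degree is g.
    y∉k : ¬ k y
    y∉k ky = g≉ε (A.trans (A.sym (A.identityˡ g)) (k-∶ (k-resp
      (solve 2 (λ α a → a :+ con true :+ a :* α :+ (a :+ con true) := a :* α) refl α a) (k-+ ky (k-+ ka k-1))) (∶-* a∶ε α∶g)))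

    θ : E.Carrier
    θ = 0# , 1#

    eval-θ : ∀ x → eval x θ ≈ x
    eval-θ x = trans (+-identityˡ _) (*-identityˡ x)

    k₂-θ : k₂ θ
    k₂-θ = k-0 , k-1

    k₂-y : k₂ (a + 1# , a)
    k₂-y = k-+ ka k-1 , ka

    eval-base : ∀ x c → eval x (c , 0#) ≈ c
    eval-base x c = trans (+-congˡ (zeroˡ x)) (+-identityʳ c)

    module _ (m n : ℕ) {c} (kc : k c) where
      -- Conjugation fixes c, so the left side equals its conjugate. The conjugate is a product of
      -- factors with constant term 1, whereas the left side has the factor α.
      same-side⇒⊥ : ¬ y ^ᴷ suc m * α ^ᴷ suc n ≈ c
      same-side⇒⊥ eq = onePlus≉α*
        (onePlus-* (onePlus-^ (suc m) ȳ-onePlus) (onePlus-^ (suc n) ᾱ-onePlus))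
        (isPoly-* (onePlus⇒isPoly (onePlus-^ (suc m) y-onePlus)) (isPoly-α^ n))
        (trans conjugate (trans (sym eq) (solve 3 (λ y α p → y :* (α :* p) := α :* (y :* p)) refl _ α _)))
        where
        X = (a + 1# , a) ^ᴱ suc m E.* θ ^ᴱ suc n
        eval-X : ∀ {t} → t * t ≈ t + a → eval t X ≈ eval t (a + 1# , a) ^ᴷ suc m * t ^ᴷ suc n
        eval-X {t} tt≈ = trans (eval-* tt≈ _ _) (*-cong (eval-^ tt≈ (a + 1# , a) (suc m))
          (trans (eval-^ tt≈ θ (suc n)) (^-congˡ (suc n) (eval-θ t))))
        conjugate : ȳ ^ᴷ suc m * ᾱ ^ᴷ suc n ≈ c
        conjugate = trans (sym (eval-X ᾱᾱ≈)) (trans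
          (conjugate-equation {X} {c , 0#} (k₂-* {(a + 1# , a) ^ᴱ suc m} {θ ^ᴱ suc n}
              (k₂-^ (suc m) k₂-y) (k₂-^ (suc n) k₂-θ)) (kc , k-0)
            (trans (eval-X αα≈) (trans eq (sym (eval-base α c)))))
          (eval-base ᾱ c))

      -- Multiplying crosswise with the conjugate equation eliminates c. One side then has constant
      -- term 1, while the other is divisible by α.
      opposite-sides⇒⊥ : ¬ y ^ᴷ suc m ≈ c * α ^ᴷ suc n
      opposite-sides⇒⊥ eq = onePlus≉α*
        (onePlus-* (onePlus-^ (suc m) y-onePlus) (onePlus-^ (suc n) ᾱ-onePlus))
        (isPoly-* (onePlus⇒isPoly (onePlus-^ (suc m) ȳ-onePlus)) (isPoly-α^ n))
        (begin
          y ^ᴷ suc m * ᾱ ^ᴷ suc n                   ≈⟨ *-congʳ eq ⟩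
          c * α ^ᴷ suc n * ᾱ ^ᴷ suc n               ≈⟨ solve 4 (λ c α p q →
            c :* (α :* p) :* q := α :* (c :* q :* p)) refl c α _ _ ⟩
          α * (c * ᾱ ^ᴷ suc n * α ^ᴷ n)             ≈⟨ *-congˡ (*-congʳ conjugate) ⟨
          α * (ȳ ^ᴷ suc m * α ^ᴷ n)                 ∎)
        where
        open SetoidReasoning setoid
        X = (c , 0#) E.* θ ^ᴱ suc n
        eval-X : ∀ {t} → t * t ≈ t + a → eval t X ≈ c * t ^ᴷ suc n
        eval-X {t} tt≈ = trans (eval-* tt≈ _ _) (*-cong (eval-base t c)
          (trans (eval-^ tt≈ θ (suc n)) (^-congˡ (suc n) (eval-θ t))))
        conjugate : ȳ ^ᴷ suc m ≈ c * ᾱ ^ᴷ suc n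
        conjugate = trans (sym (eval-^ ᾱᾱ≈ (a + 1# , a) (suc m))) (trans
          (conjugate-equation {(a + 1# , a) ^ᴱ suc m} {X} (k₂-^ (suc m) k₂-y)
              (k₂-* {c , 0#} {θ ^ᴱ suc n} (kc , k-0) (k₂-^ (suc n) k₂-θ))
            (trans (eval-^ αα≈ (a + 1# , a) (suc m)) (trans eq (sym (eval-X αα≈)))))
          (eval-X ᾱᾱ≈))

    impossible : Empty.⊥
    impossible with grade? y
    ... | inj₁ y≈0 = y∉k (inj₁ y≈0)
    ... | inj₂ (b , y∶b) with rankOne (λ b≈ε → y∉k (inj₂ (∶-resp refl b≈ε y∶b))) g≉ε
    ... | m , n , inj₁ mb≈ng
      with c , c∈ , eq ← ∼-trans (∶-resp refl mb≈ng (∶-^ (suc m) y∶b)) (∼-sym (∶-^ (suc n) α∶g)) =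
      opposite-sides⇒⊥ m n (inj₂ (member⇒∶ε c∈)) eq
    ... | m , n , inj₂ mb+ng≈ε = same-side⇒⊥ m n (inj₂ (∶-resp refl mb+ng≈ε (∶-* (∶-^ (suc m) y∶b) (∶-^ (suc n) α∶g)))) refl

-- Non-elementarity, given a suitable group.

module _ {ℓ} (A : AbelianGroup ℓ ℓ) (_≟_ : Decidable (AbelianGroup._≈_ A))
         (good : ∀ N → Combinations.Good A N) (rankOne : RankOne A) where
  private module A = Combinations A

  ¬isKrasner-line : ¬ IsKrasner (LineStructure.structure A)
  ¬isKrasner-line (_ , K , G , iso) =
    let s , t , s∶ε , t∶ε , αα≈ = quadratic α∶g g≉ε 2-torsionFree
        i , si≈1 = inverse s (∶⇒≉0 s∶ε)
        2≈0 = characteristic-2 α∶g g≉ε 2-torsionFree (inj₂ s∶ε) (inj₂ t∶ε) αα≈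
        i∶ε = ∶-resp refl (A.inverseˡ A.ε) (∶-quotient s∶ε (∶-resp (sym si≈1) A.refl ∶-1))
    in ArtinSchreier.impossible good rankOne 2≈0
         (∶-resp refl (A.identityˡ g) (∶-* i∶ε α∶g)) g≉ε
         (∶-resp refl (A.trans (A.identityˡ _) (A.identityˡ _)) (∶-* i∶ε (∶-* i∶ε t∶ε)))
         (normalise si≈1 αα≈)
    where
    open Field K
    open Grading A _≟_ K G iso
    g = proj₁ (A.Good.nontrivial (good 0))
    g≉ε = proj₂ (A.Good.nontrivial (good 0))

    2-torsionFree : ∀ {x} → x A.∙ x A.≈ A.ε → x A.≈ A.ε
    2-torsionFree {x} xx≈ε = A.Good.·-cancel (good 2) 1 (s≤s (s≤s z≤n))
      (A.trans (A.∙-congˡ (A.identityʳ x)) (A.trans xx≈ε (A.sym (A.·-ε 2))))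

    α∶g : _≅_.to iso (just g) ∶ g
    α∶g = ∼-refl

    -- Passing from α to α / s makes the linear coefficient 1 and turns t into a = t / s². As s has
    -- degree ε, the degree of α is unchanged.
    normalise : ∀ {α s t i} → s * i ≈ 1# → α * α ≈ s * α + t → i * α * (i * α) ≈ i * α + i * (i * t)
    normalise {α} {s} {t} {i} si≈1 αα≈ = begin
      i * α * (i * α)                ≈⟨ solve 2 (λ i α → i :* α :* (i :* α) := i :* i :* (α :* α)) refl i α ⟩
      i * i * (α * α)                ≈⟨ *-congˡ αα≈ ⟩
      i * i * (s * α + t)            ≈⟨ solve 4 (λ i s α t →
        i :* i :* (s :* α :+ t) := s :* i :* (i :* α) :+ i :* (i :* t)) refl i s α t ⟩
      s * i * (i * α) + i * (i * t)  ≈⟨ +-congʳ (trans (*-congʳ si≈1) (*-identityˡ _)) ⟩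
      i * α + i * (i * t)            ∎
      where
      open SetoidReasoning setoid
      open SemiringSolver commutativeSemiring using (solve; _:=_; _:+_; _:*_)

  line-transfer : ∀ {M} (L : Line M) φ → Combinations.Good (Line.group L) (suc (bound φ)) →
                  Sat M φ [] → Sat (LineStructure.structure A) φ []
  line-transfer L φ L-good = transfer φ {L = L} {L′ = LineStructure.line A _≟_} (record
    { good = Combinations.Good-anti _ (ℕ.n≤1+n (bound φ)) L-good ; good′ = good (bound φ)
    ; zeros = [] ; coords = [] ; coords′ = []
    ; represents = λ () ; represents′ = λ ()
    ; preserves = λ { [] [] _ _ _ → A.refl }
    ; preserves⁻ = λ { [] [] _ _ _ → AbelianGroup.refl (Line.group L) } })

  -- The Krasner model may depend on the axiom: it is chosen according to `bound φ`.
  ⊨-line : ∀ {t} (T : Pred Sentence t) → (∀ M → IsKrasner M → M ⊨ T) → LineStructure.structure A ⊨ T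
  ⊨-line T krasner⊨T φ φ∈T = from-model (krasnerModel (bound φ))
    where
    from-model : (Σ (LStructure ℓ) λ M →
                   IsKrasner M × Σ (Line M) λ L → Combinations.Good (Line.group L) (suc (bound φ))) →
                 Sat (LineStructure.structure A) φ []
    from-model (M , M-krasner , L , L-good) = line-transfer L φ L-good (krasner⊨T M M-krasner φ φ∈T)

  ¬elementary : ∀ {t} → ¬ IsElementary t (IsKrasner {ℓ})
  ¬elementary (T , axioms) =
    ¬isKrasner-line (Equivalence.to (axioms _) (⊨-line T (λ M → Equivalence.from (axioms M))))

-- The additive group of the rationals.

module Rationals (ℓ : Level) where
  open CommutativeRing (liftRing ℓ ℚᵘ.+-*-commutativeRing) public using (+-abelianGroup)
  open Combinations +-abelianGroup
  open ℤSolver.+-*-Solver using (solve; _:=_; _:+_; _:*_; :-_; con)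

  _≟ℚ_ : Decidable _≈_
  lift x ≟ℚ lift y = map′ lift lower (x ℚᵘ.≃? y)

  ·-formula : ∀ n p d → lower (n · lift (mkℚᵘ p d)) ≃ mkℚᵘ (+ n ℤ.* p) d
  ·-formula zero    p d = *≡* (≡.cong (ℤ._* ℤ.1ℤ) (≡.sym (ℤ.*-zeroˡ p)))
  ·-formula (suc n) p d = ℚᵘ.≃-trans (ℚᵘ.+-congʳ (mkℚᵘ p d) (·-formula n p d)) (*≡*
    (≡.trans (solve 3 (λ n p D → (p :* D :+ n :* p :* D) :* D := (con ℤ.1ℤ :+ n) :* p :* (D :* D)) ≡.refl (+ n) p (+[1+ d ]))
      (≡.cong (λ D² → (+[1+ n ] ℤ.* p) ℤ.* D²) (≡.sym (ℤ.pos-* (suc d) (suc d))))))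

  ℚ-good : ∀ N → Good N
  ℚ-good N = record
    { ·-cancel = λ { m _ {lift (mkℚᵘ p d)} {lift (mkℚᵘ p′ d′)} (lift eq) → lift (cancel m p d p′ d′
        (ℚᵘ.≃-trans (ℚᵘ.≃-sym (·-formula (suc m) p d)) (ℚᵘ.≃-trans eq (·-formula (suc m) p′ d′)))) }
    -- Denominators are stored as predecessors: the successor of `d + m * suc d` is (1 + m)(1 + d).
    ; divide = λ { m _ (lift (mkℚᵘ p d)) → lift (mkℚᵘ p (d ℕ.+ m ℕ.* suc d)) ,
        lift (ℚᵘ.≃-trans (·-formula (suc m) p _) (*≡* (≡.trans
          (solve 3 (λ m p D → m :* p :* D := p :* (m :* D)) ≡.refl (+[1+ m ]) p (+[1+ d ]))
          (≡.cong (p ℤ.*_) (≡.sym (ℤ.pos-* (suc m) (suc d))))))) }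
    ; nontrivial = lift ℚᵘ.1ℚᵘ , λ { (lift (*≡* ())) } }
    where
    cancel : ∀ m p d p′ d′ → mkℚᵘ (+[1+ m ] ℤ.* p) d ≃ mkℚᵘ (+[1+ m ] ℤ.* p′) d′ → mkℚᵘ p d ≃ mkℚᵘ p′ d′
    cancel m p d p′ d′ (*≡* eq) = *≡* (ℤ.*-cancelˡ-≡ +[1+ m ] _ _
      (≡.trans (≡.sym (ℤ.*-assoc +[1+ m ] p _)) (≡.trans eq (ℤ.*-assoc +[1+ m ] p′ _))))

  private
    expand : ∀ a b c → + (suc a ℕ.* suc b) ℤ.* c ≡ +[1+ a ] ℤ.* +[1+ b ] ℤ.* c
    expand a b c = ≡.cong (ℤ._* c) (ℤ.pos-* (suc a) (suc b))

    proportional : ∀ u v p d q e → +[1+ v ] ℤ.* p ≡ +[1+ u ] ℤ.* q →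
                   (suc v ℕ.* suc d) · lift (mkℚᵘ p d) ≈ (suc u ℕ.* suc e) · lift (mkℚᵘ q e)
    proportional u v p d q e vp≡uq = lift (ℚᵘ.≃-trans (·-formula (suc v ℕ.* suc d) p d)
      (ℚᵘ.≃-trans (*≡* (begin
        + (suc v ℕ.* suc d) ℤ.* p ℤ.* +[1+ e ]     ≡⟨ ≡.cong (ℤ._* +[1+ e ]) (expand v d p) ⟩
        +[1+ v ] ℤ.* D ℤ.* p ℤ.* E                 ≡⟨ solve 4 (λ v p D E →
          v :* D :* p :* E := v :* p :* (D :* E)) ≡.refl +[1+ v ] p D E ⟩
        +[1+ v ] ℤ.* p ℤ.* (D ℤ.* E)               ≡⟨ ≡.cong (ℤ._* (D ℤ.* E)) vp≡uq ⟩
        +[1+ u ] ℤ.* q ℤ.* (D ℤ.* E)               ≡⟨ solve 4 (λ u q D E →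
          u :* q :* (D :* E) := u :* E :* q :* D) ≡.refl +[1+ u ] q D E ⟩
        +[1+ u ] ℤ.* E ℤ.* q ℤ.* D                 ≡⟨ ≡.cong (ℤ._* D) (expand u e q) ⟨
        + (suc u ℕ.* suc e) ℤ.* q ℤ.* +[1+ d ]     ∎))
      (ℚᵘ.≃-sym (·-formula (suc u ℕ.* suc e) q e))))
      where
      open ≡.≡-Reasoning
      D = +[1+ d ]
      E = +[1+ e ]

    neg-lift : ∀ n q e → n · lift (mkℚᵘ (ℤ.- q) e) ≈ (n · lift (mkℚᵘ q e)) ⁻¹
    neg-lift n q e = lift (ℚᵘ.≃-trans (·-formula n (ℤ.- q) e) (ℚᵘ.≃-trans
      (*≡* (≡.cong (ℤ._* +[1+ e ]) (≡.sym (ℤ.neg-distribʳ-* (+ n) q))))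
      (ℚᵘ.≃-sym (ℚᵘ.-‿cong (·-formula n q e)))))

  private
    negated : ∀ p q → +[1+ q ] ℤ.* -[1+ p ] ≡ +[1+ p ] ℤ.* -[1+ q ]
    negated p q = solve 2 (λ p q → q :* (:- p) := p :* (:- q)) ≡.refl +[1+ p ] +[1+ q ]

    PairRelation : Carrier → Carrier → Set ℓ
    PairRelation x y = ∃₂ λ m n → suc m · x ≈ suc n · y ⊎ suc m · x ∙ suc n · y ≈ ε

    relation-same : ∀ u v p d q e → +[1+ v ] ℤ.* p ≡ +[1+ u ] ℤ.* q → PairRelation (lift (mkℚᵘ p d)) (lift (mkℚᵘ q e))
    relation-same u v p d q e eq = d ℕ.+ v ℕ.* suc d , e ℕ.+ u ℕ.* suc e , inj₁ (proportional u v p d q e eq)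

    relation-opposite : ∀ u v p d q e → +[1+ v ] ℤ.* p ≡ +[1+ u ] ℤ.* (ℤ.- q) →
                        PairRelation (lift (mkℚᵘ p d)) (lift (mkℚᵘ q e))
    relation-opposite u v p d q e eq = d ℕ.+ v ℕ.* suc d , e ℕ.+ u ℕ.* suc e , inj₂ (begin
      M · lift (mkℚᵘ p d) ∙ N · lift (mkℚᵘ q e)            ≈⟨ ∙-congʳ (proportional u v p d (ℤ.- q) e eq) ⟩
      N · lift (mkℚᵘ (ℤ.- q) e) ∙ N · lift (mkℚᵘ q e)      ≈⟨ ∙-congʳ (neg-lift N q e) ⟩
      (N · lift (mkℚᵘ q e)) ⁻¹ ∙ N · lift (mkℚᵘ q e)       ≈⟨ inverseˡ (N · lift (mkℚᵘ q e)) ⟩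
      ε                                                    ∎)
      where
      open SetoidReasoning setoid
      M = suc v ℕ.* suc d
      N = suc u ℕ.* suc e

  -- For x = p / d and y = q / e the multipliers are |q| d and |p| e. Equal signs give an equality,
  -- opposite signs a vanishing sum.
  ℚ-rankOne : RankOne +-abelianGroup
  ℚ-rankOne {lift (mkℚᵘ +0 d)}       {_}                       x≉0 _   = contradiction (lift (*≡* ≡.refl)) x≉0
  ℚ-rankOne {lift (mkℚᵘ _ d)}        {lift (mkℚᵘ +0 e)}        _   y≉0 = contradiction (lift (*≡* ≡.refl)) y≉0
  ℚ-rankOne {lift (mkℚᵘ +[1+ p ] d)} {lift (mkℚᵘ +[1+ q ] e)} _   _   =
    relation-same p q +[1+ p ] d +[1+ q ] e (ℤ.*-comm +[1+ q ] +[1+ p ])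
  ℚ-rankOne {lift (mkℚᵘ +[1+ p ] d)} {lift (mkℚᵘ -[1+ q ] e)} _   _   =
    relation-opposite p q +[1+ p ] d -[1+ q ] e (ℤ.*-comm +[1+ q ] +[1+ p ])
  ℚ-rankOne {lift (mkℚᵘ -[1+ p ] d)} {lift (mkℚᵘ +[1+ q ] e)} _   _   =
    relation-opposite p q -[1+ p ] d +[1+ q ] e (negated p q)
  ℚ-rankOne {lift (mkℚᵘ -[1+ p ] d)} {lift (mkℚᵘ -[1+ q ] e)} _   _   =
    relation-same p q -[1+ p ] d -[1+ q ] e (negated p q)

corollary3p9 : (ℓ t : Level) → ¬ IsElementary t (IsKrasner {ℓ})
corollary3p9 ℓ t = ¬elementary +-abelianGroup _≟ℚ_ ℚ-good ℚ-rankOne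
  where open Rationals ℓ
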